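{- For $k\ge0$ write $3^k=\sum_{i\ge0}\omega_i(k)2^i$ with $\omega_i(k)\in\{0,1\}$ (the binary expansion), and let $A_k=\{i\ge0:\omega_i(k)=1\}$. Let \[ W=\{k\in\mathbb{N}: A_k \text{ contains no 3-term arithmetic progression}\}. \] Then for every $\varepsilon>0$, $\#(W\cap[1,N])=O_\varepsilon(N^{\varepsilon})$.
   Context: A 3-term arithmetic progression in a set $A$ of integers means $a,a+d,a+2d\in A$ with $d\ge1$. -}

module Defs where

open import Data.Digit using (Bit; 0b; 1b; Expansion; toDigits)
open import Data.Fin.Properties using () renaming (_≟_ to _≟ᶠ_)
open import Data.Integer.Base using (+_; -[1+_])
open import Data.List.Base using ([]; _∷_; length; filter; applyUpTo)
open import Data.Nat.Base using (ℕ; zero; suc; _+_; _*_; _^_; _≤_; _<_; z≤n; s≤s)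
open import Data.Nat.Properties using (_≤?_; anyUpTo?; ≤-<-trans; m≤n+m)
open import Data.Product.Base using (∃-syntax; _×_; _,_; proj₁)
open import Data.Rational.Base as ℚ using (ℚ; 0ℚ; ↥_; ↧ₙ_)
open import Data.Sum.Base using (_⊎_)
open import Function.Bundles using (_⇔_)
open import Level using (0ℓ)
open import Relation.Binary.PropositionalEquality using (_≡_)
open import Relation.Nullary using (¬_; ¬?)
open import Relation.Nullary.Decidable using (_×-dec_; map′)
open import Relation.Unary using (Pred; Decidable; Satisfiable; _∈_)

-- A little-endian expansion read as a sequence indexed by all of ℕ.
digitAt : Expansion 2 → ℕ → Bit
digitAt []       _       = 0b
digitAt (b ∷ _)  zero    = b
digitAt (_ ∷ bs) (suc i) = digitAt bs i

binary : ℕ → Expansion 2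
binary n = proj₁ (toDigits 2 n)

ω : ℕ → ℕ → Bit
ω i k = digitAt (binary (3 ^ k)) i

A : ℕ → Pred ℕ 0ℓ
A k i = ω i k ≡ 1b

Contains3AP : Pred ℕ 0ℓ → Set
Contains3AP S = ∃[ a ] ∃[ d ] (1 ≤ d × a ∈ S × a + d ∈ S × a + 2 * d ∈ S)

W : Pred ℕ 0ℓ
W k = ¬ Contains3AP (A k)

digitAt≡1⇒<length : ∀ bs i → digitAt bs i ≡ 1b → i < length bs
digitAt≡1⇒<length []       _       ()
digitAt≡1⇒<length (_ ∷ _)  zero    _  = s≤s z≤n
digitAt≡1⇒<length (_ ∷ bs) (suc i) eq = s≤s (digitAt≡1⇒<length bs i eq)

W? : Decidable W
W? k = ¬? (map′ forget bound (anyUpTo? (λ a → anyUpTo? (ap? a) ℓ) ℓ))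
  where
  ℓ : ℕ
  ℓ = length (binary (3 ^ k))

  AP : ℕ → ℕ → Set
  AP a d = 1 ≤ d × a ∈ A k × a + d ∈ A k × a + 2 * d ∈ A k

  A? : Decidable (A k)
  A? i = ω i k ≟ᶠ 1b

  ap? : ∀ a → Decidable (AP a)
  ap? a d = (1 ≤? d) ×-dec A? a ×-dec A? (a + d) ×-dec A? (a + 2 * d)

  forget : (∃[ a ] (a < ℓ × ∃[ d ] (d < ℓ × AP a d))) → Contains3AP (A k)
  forget (a , _ , d , _ , p) = a , d , p

  bound : Contains3AP (A k) → ∃[ a ] (a < ℓ × ∃[ d ] (d < ℓ × AP a d))
  bound (a , d , p@(_ , a∈ , a+d∈ , _)) =
    a , <ℓ a a∈ , d , ≤-<-trans (m≤n+m d a) (<ℓ (a + d) a+d∈) , p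
    where
    <ℓ : ∀ i → i ∈ A k → i < ℓ
    <ℓ = digitAt≡1⇒<length (binary (3 ^ k))

#W∩[1,_] : ℕ → ℕ
#W∩[1, N ] = length (filter W? (applyUpTo suc N))

-- Two-sided Dedekind cuts: lower q means q < x, upper q means x < q.
record ℝ : Set₁ where
  field
    lower upper     : Pred ℚ 0ℓ
    lower-inhabited : Satisfiable lower
    upper-inhabited : Satisfiable upper
    lower-rounded   : ∀ q → q ∈ lower ⇔ (∃[ r ] (q ℚ.< r × r ∈ lower))
    upper-rounded   : ∀ r → r ∈ upper ⇔ (∃[ q ] (q ℚ.< r × q ∈ upper))
    disjoint        : ∀ q → ¬ (q ∈ lower × q ∈ upper)
    located         : ∀ q r → q ℚ.< r → q ∈ lower ⊎ r ∈ upper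

Positive : ℝ → Set
Positive x = 0ℚ ∈ ℝ.lower x

-- m ≤ C · N ^ r for N ≥ 1 and r = p / q with q > 0: both sides are raised to
-- the power q, and a negative power of N is moved to the left-hand side.
_≤_·_^ℚ_ : ℕ → ℕ → ℕ → ℚ → Set
m ≤ C · N ^ℚ r with ↥ r
... | + p      = m ^ ↧ₙ r ≤ C ^ ↧ₙ r * N ^ p
... | -[1+ p ] = m ^ ↧ₙ r * N ^ suc p ≤ C ^ ↧ₙ r

-- m ≤ C · N ^ x for N ≥ 1, where N ^ x is the infimum of N ^ r over rational
-- r > x.
_≤_·_^ℝ_ : ℕ → ℕ → ℕ → ℝ → Set
m ≤ C · N ^ℝ x = ∀ r → r ∈ ℝ.upper x → m ≤ C · N ^ℚ r

{-# OPTIONS --safe #-}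
module Submission where

-- The residue of 3ᵏ modulo 2^(m+2) determines k modulo 2^m, so the low digits of 3ᵏ
-- distinguish the elements of W ∩ [1, N] already on an initial segment of length
-- M ≈ log₂ N, where each is a progression-free word. By Roth's theorem such words have
-- o(M) ones, and there are only 2^o(M) = N^o(1) of them.
--
-- Roth's theorem is proved by Szemerédi's cube argument as a density decrement: suppose
-- that progressions of length n carry density at most c/E, yet f has density more than
-- (c−1)/E on [0, 4L). Then f contains a Hilbert cube of large dimension and bounded
-- steps dᵢ based at some a ∈ [L, 2L). Reflecting f ∩ [0, L) in larger and larger
-- subcubes yields increasing sets N₀ ⊆ N₁ ⊆ …, all disjoint from f, with
-- Nᵢ₊₁ = Nᵢ ∪ (Nᵢ + 2dᵢ). Some Nᵢ is almost invariant under translation by 2d, so its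
-- complement is nearly a union of long progressions of difference 2d, on which f has
-- density at most c/E; hence f has density at most about (c/E)(1 − c/E), a contradiction.

open import Defs
open import Data.Bool.Base using (Bool; true; false; _∧_; _∨_; not; if_then_else_)
open import Data.Bool.Properties using () renaming (_≟_ to _≟ᵇ_)
open import Data.Digit using (Bit; 1b; Expansion; fromDigits; toDigits)
open import Data.Empty using (⊥; ⊥-elim)
open import Data.Fin.Base using (zero; suc; toℕ)
import Data.Integer.Base as ℤ
import Data.Integer.Properties as ℤ
open import Data.List.Base using (List; []; _∷_; length; filter; map; applyUpTo)
open import Data.List.Relation.Unary.All as All using (All; []; _∷_)
open import Data.List.Relation.Unary.All.Properties using (all-filter)
open import Data.List.Relation.Unary.AllPairs using (AllPairs; []; _∷_)
import Data.List.Relation.Unary.AllPairs.Properties as AllPairs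
open import Data.Nat.Base using (ℕ; zero; suc; _+_; _*_; _∸_; _^_; _≤_; _<_; z≤n; s≤s; NonZero; >-nonZero; >-nonZero⁻¹)
open import Data.Nat.DivMod using (_/_; m/n*n≤m; m≡m%n+[m/n]*n; m%n<n; m*n/n≡m; /-monoˡ-≤)
open import Data.Nat.Divisibility using (_∣_; _∣?_; divides; 1∣_; ∣⇒≤; ∣-trans; m∣m*n; ∣m+n∣m⇒∣n; *-monoʳ-∣; *-cancelˡ-∣)
open import Data.Nat.ListAction using (sum)
open import Data.Nat.Properties
open import Data.Nat.Tactic.RingSolver using (solve-∀)
open import Data.Product.Base using (∃-syntax; _×_; _,_; proj₂)
open import Data.Rational.Base as ℚ using (mkℚ; 0ℚ; ↧ₙ_; *<*)
import Data.Rational.Properties as ℚ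
open import Data.Sum.Base using (_⊎_; inj₁; inj₂)
open import Function.Base using (_∘_)
open import Function.Bundles using (Equivalence)
open import Relation.Binary.Definitions using (tri<; tri≈; tri>)
open import Relation.Binary.PropositionalEquality using (_≡_; refl; sym; trans; cong; cong₂; subst; module ≡-Reasoning)
open import Relation.Nullary using (¬_; yes; no; contradiction)
open import Relation.Nullary.Decidable using (from-no)

-- Reduces a linear combination p ≤ q of known inequalities to a semiring identity; s is the slack.
≤-by : ∀ {p q a b} s → p ≤ q → a + q + s ≡ b + p → a ≤ b
≤-by {p} {q} {a} {b} s p≤q eq = +-cancelʳ-≤ q a b (begin
  a + q      ≤⟨ m≤m+n (a + q) s ⟩
  a + q + s  ≡⟨ eq ⟩
  b + p      ≤⟨ +-monoʳ-≤ b p≤q ⟩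
  b + q      ∎)
  where open ≤-Reasoning

-- Finite sums

∑ : ℕ → (ℕ → ℕ) → ℕ
∑ zero    u = 0
∑ (suc n) u = u 0 + ∑ n (u ∘ suc)

∑-mono-< : ∀ n {u v} → (∀ i → i < n → u i ≤ v i) → ∑ n u ≤ ∑ n v
∑-mono-< zero    u≤v = z≤n
∑-mono-< (suc n) u≤v = +-mono-≤ (u≤v 0 (s≤s z≤n)) (∑-mono-< n λ i i<n → u≤v (suc i) (s≤s i<n))

∑-mono : ∀ n {u v} → (∀ i → u i ≤ v i) → ∑ n u ≤ ∑ n v
∑-mono n u≤v = ∑-mono-< n λ i _ → u≤v i

∑-cong : ∀ n {u v} → (∀ i → u i ≡ v i) → ∑ n u ≡ ∑ n v
∑-cong zero    u≡v = refl
∑-cong (suc n) u≡v = cong₂ _+_ (u≡v 0) (∑-cong n (u≡v ∘ suc))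

∑-+ : ∀ n u v → ∑ n (λ i → u i + v i) ≡ ∑ n u + ∑ n v
∑-+ zero    u v = refl
∑-+ (suc n) u v rewrite ∑-+ n (u ∘ suc) (v ∘ suc) = interchange (u 0) (v 0) _ _
  where
  interchange : ∀ a b c d → a + b + (c + d) ≡ a + c + (b + d)
  interchange = solve-∀

∑-*ˡ : ∀ n c u → ∑ n (λ i → c * u i) ≡ c * ∑ n u
∑-*ˡ zero    c u = sym (*-zeroʳ c)
∑-*ˡ (suc n) c u rewrite ∑-*ˡ n c (u ∘ suc) = sym (*-distribˡ-+ c (u 0) _)

∑-const : ∀ n c → ∑ n (λ _ → c) ≡ n * c
∑-const zero    c = refl
∑-const (suc n) c = cong (c +_) (∑-const n c)

∑-swap : ∀ m n (u : ℕ → ℕ → ℕ) → ∑ m (λ i → ∑ n (u i)) ≡ ∑ n (λ j → ∑ m (λ i → u i j))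
∑-swap zero    n u = sym (trans (∑-const n 0) (*-zeroʳ n))
∑-swap (suc m) n u rewrite ∑-swap m n (u ∘ suc) = sym (∑-+ n (u 0) _)

∑-split : ∀ m n u → ∑ (m + n) u ≡ ∑ m u + ∑ n (λ i → u (m + i))
∑-split zero    n u = refl
∑-split (suc m) n u rewrite ∑-split m n (u ∘ suc) = sym (+-assoc (u 0) _ _)

∑-suc : ∀ n u → ∑ (suc n) u ≡ ∑ n u + u n
∑-suc zero    u = +-comm (u 0) 0
∑-suc (suc n) u rewrite ∑-suc n (u ∘ suc) = sym (+-assoc (u 0) _ _)

∑-monoˡ : ∀ {m n} u → m ≤ n → ∑ m u ≤ ∑ n u
∑-monoˡ u z≤n       = z≤n
∑-monoˡ u (s≤s m≤n) = +-monoʳ-≤ (u 0) (∑-monoˡ (u ∘ suc) m≤n)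

∑-tile : ∀ n r {u v : ℕ → ℕ} →
         (∀ a ℓ → ℓ ≤ n → ∑ ℓ (u ∘ (a +_)) ≤ r + ∑ ℓ (v ∘ (a +_))) →
         ∀ x L → L ≤ x * n → ∑ L u ≤ x * r + ∑ L v
∑-tile n r {u} {v} tile = go 0
  where
  open ≤-Reasoning
  go : ∀ a x L → L ≤ x * n → ∑ L (u ∘ (a +_)) ≤ x * r + ∑ L (v ∘ (a +_))
  go a zero    zero L≤ = z≤n
  go a (suc x) L    L≤ with ≤-total L n
  ... | inj₁ L≤n = ≤-trans (tile a L L≤n) (+-monoˡ-≤ _ (m≤m+n r (x * r)))
  ... | inj₂ n≤L = subst (λ k → ∑ k (u ∘ (a +_)) ≤ suc x * r + ∑ k (v ∘ (a +_))) (m+[n∸m]≡n n≤L) (begin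
    ∑ (n + L′) (u ∘ (a +_))                        ≡⟨ ∑-split n L′ _ ⟩
    ∑ n (u ∘ (a +_)) + ∑ L′ (λ i → u (a + (n + i))) ≡⟨ cong (∑ n (u ∘ (a +_)) +_) (∑-cong L′ λ i → cong u (sym (+-assoc a n i))) ⟩
    ∑ n (u ∘ (a +_)) + ∑ L′ (u ∘ (a + n +_))        ≤⟨ +-mono-≤ (tile a n ≤-refl) (go (a + n) x L′ L′≤) ⟩
    r + V + (x * r + ∑ L′ (v ∘ (a + n +_)))         ≡⟨ cong (λ k → r + V + (x * r + k)) (∑-cong L′ λ i → cong v (+-assoc a n i)) ⟩
    r + V + (x * r + V′)                            ≡⟨ rearrange r V (x * r) V′ ⟩
    suc x * r + (V + V′)                            ≡⟨ cong (suc x * r +_) (∑-split n L′ _) ⟨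
    suc x * r + ∑ (n + L′) (v ∘ (a +_))             ∎)
    where
    L′ V V′ : ℕ
    L′ = L ∸ n
    V  = ∑ n (v ∘ (a +_))
    V′ = ∑ L′ (λ i → v (a + (n + i)))
    L′≤ : L′ ≤ x * n
    L′≤ = ≤-trans (∸-monoˡ-≤ n L≤) (≤-reflexive (m+n∸m≡n n (x * n)))
    rearrange : ∀ a b c d → a + b + (c + d) ≡ a + c + (b + d)
    rearrange = solve-∀

∑-pigeonhole : ∀ n y u → suc n * y ≤ ∑ (suc n) u → ∃[ i ] (i ≤ n × y ≤ u i)
∑-pigeonhole n y u h with y ≤? u 0
... | yes y≤ = 0 , z≤n , y≤
∑-pigeonhole zero    y u h | no y≰ = contradiction (≤-trans (≤-reflexive (sym (+-identityʳ y))) (≤-trans h (≤-reflexive (+-identityʳ (u 0))))) y≰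
∑-pigeonhole (suc n) y u h | no y≰
  with i , i≤n , y≤ ← ∑-pigeonhole n y (u ∘ suc) (+-cancelˡ-≤ y _ _ (≤-trans h (+-monoˡ-≤ _ (≰⇒≥ y≰))))
  = suc i , s≤s i≤n , y≤

-- Counting functions of Boolean sets

⟦_⟧ : Bool → ℕ
⟦ true  ⟧ = 1
⟦ false ⟧ = 0

⟦⟧≤1 : ∀ b → ⟦ b ⟧ ≤ 1
⟦⟧≤1 true  = ≤-refl
⟦⟧≤1 false = z≤n

cnt : (ℕ → Bool) → ℕ → ℕ
cnt f n = ∑ n (⟦_⟧ ∘ f)

cnt≤ : ∀ f n → cnt f n ≤ n
cnt≤ f n = ≤-trans (∑-mono n (⟦⟧≤1 ∘ f)) (≤-reflexive (trans (∑-const n 1) (*-identityʳ n)))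

cnt-split : ∀ f m n → cnt f (m + n) ≡ cnt f m + cnt (f ∘ (m +_)) n
cnt-split f m n = ∑-split m n (⟦_⟧ ∘ f)

cnt-not : ∀ f n → cnt (not ∘ f) n + cnt f n ≡ n
cnt-not f n = trans (sym (∑-+ n _ _)) (trans (∑-cong n (one ∘ f)) (trans (∑-const n 1) (*-identityʳ n)))
  where
  one : ∀ b → ⟦ not b ⟧ + ⟦ b ⟧ ≡ 1
  one true  = refl
  one false = refl

cnt-≤-shift : ∀ f s n → cnt f n ≤ cnt (f ∘ (s +_)) n + s
cnt-≤-shift f s n = begin
  cnt f n                          ≤⟨ ∑-monoˡ (⟦_⟧ ∘ f) (m≤n+m n s) ⟩
  cnt f (s + n)                    ≡⟨ cnt-split f s n ⟩
  cnt f s + cnt (f ∘ (s +_)) n     ≤⟨ +-monoˡ-≤ _ (cnt≤ f s) ⟩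
  s + cnt (f ∘ (s +_)) n           ≡⟨ +-comm s _ ⟩
  cnt (f ∘ (s +_)) n + s           ∎
  where open ≤-Reasoning

cnt-+-≤ : ∀ f s n → cnt f (s + n) ≤ cnt f n + s
cnt-+-≤ f s n = begin
  cnt f (s + n)                 ≡⟨ cong (cnt f) (+-comm s n) ⟩
  cnt f (n + s)                 ≡⟨ cnt-split f n s ⟩
  cnt f n + cnt (f ∘ (n +_)) s  ≤⟨ +-monoʳ-≤ _ (cnt≤ _ s) ⟩
  cnt f n + s                   ∎
  where open ≤-Reasoning

cnt-shift-≤ : ∀ f s n → cnt (f ∘ (s +_)) n ≤ cnt f n + s
cnt-shift-≤ f s n = begin
  cnt (f ∘ (s +_)) n            ≤⟨ m≤n+m _ (cnt f s) ⟩
  cnt f s + cnt (f ∘ (s +_)) n  ≡⟨ cnt-split f s n ⟨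
  cnt f (s + n)                 ≤⟨ cnt-+-≤ f s n ⟩
  cnt f n + s                   ∎
  where open ≤-Reasoning

∧-true : ∀ {x y} → x ∧ y ≡ true → x ≡ true × y ≡ true
∧-true {true} {true} _ = refl , refl

-- Hilbert cubes

-- The Hilbert cube of all `m` plus subset sums of the steps. Dropping the first step leaves two
-- subcubes, based at `m` and `m + d`.
cube : (ℕ → Bool) → List ℕ → ℕ → Set
cube f []       m = f m ≡ true
cube f (d ∷ ds) m = cube f ds m × cube f ds (m + d)

meet : ℕ → (ℕ → Bool) → ℕ → Bool
meet d g x = g x ∧ g (x + d)

cube-base : ∀ {f} ds {m} → cube f ds m → f m ≡ true
cube-base []       c       = c
cube-base (_ ∷ ds) (c , _) = cube-base ds c

cube-meet : ∀ {d g} ds {a} → cube (meet d g) ds a → cube g (d ∷ ds) a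
cube-meet         []       c = ∧-true c
cube-meet {d} {g} (e ∷ ds) {a} (c₀ , c₁) with cube-meet ds c₀ | cube-meet ds c₁
... | p , p+d | p+e , p+e+d = (p , p+e) , (p+d , subst (cube g ds) (swap a e d) p+e+d)
  where
  swap : ∀ a e d → a + e + d ≡ a + d + e
  swap = solve-∀

cube-shift : ∀ {f} b ds {m} → cube (f ∘ (b +_)) ds m → cube f ds (b + m)
cube-shift         b []       c         = c
cube-shift {f} b (d ∷ ds) {m} (c₀ , c₁) =
  cube-shift b ds c₀ , subst (cube f ds) (sym (+-assoc b m d)) (cube-shift b ds c₁)

cnt-witness : ∀ g L → 1 ≤ cnt g L → ∃[ a ] (a < L × g a ≡ true)
cnt-witness g (suc L) h with g 0 in eq
... | true  = 0 , s≤s z≤n , eq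
... | false with a , a<L , ga ← cnt-witness (g ∘ suc) L h = suc a , s≤s a<L , ga

-- The first element of `g` in the window pairs with each later one, all within distance `T`; only
-- that element itself is left over, whence the 1.
cnt-≤-pairs : ∀ g T ℓ → ℓ ≤ T → cnt g ℓ ≤ 1 + ∑ ℓ (λ x → ∑ T (λ d → ⟦ meet (suc d) g x ⟧))
cnt-≤-pairs g T zero    ℓ≤T = z≤n
cnt-≤-pairs g T (suc ℓ) ℓ≤T with g 0
... | true  = s≤s (≤-trans (∑-monoˡ _ (<⇒≤ ℓ≤T)) (m≤m+n _ _))
... | false = ≤-trans (cnt-≤-pairs (g ∘ suc) T ℓ (<⇒≤ ℓ≤T)) (s≤s (m≤n+m _ _))

≤-suc-/ : ∀ m n .{{_ : NonZero n}} → m ≤ suc (m / n) * n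
≤-suc-/ m n = ≤-trans (≤-reflexive (m≡m%n+[m/n]*n m n)) (+-monoˡ-≤ (m / n * n) (<⇒≤ (m%n<n m n)))

-- Cut [0, L) into windows of length `T = 4 q + 1`. By `cnt-≤-pairs`, close pairs number at least
-- the elements minus the windows, and this `T` makes the windows at most half as many as the
-- elements. Some difference gets its share of the pairs.
popular-difference : ∀ q L g → suc (4 * q) ≤ L → L ≤ q * cnt g L →
  ∃[ d ] (d ≤ 4 * q × L ≤ suc (4 * q) * suc (4 * q) * cnt (meet (suc d) g) L)
popular-difference q L g T≤L dense = ∑-pigeonhole (4 * q) L _ (begin
  T * L                                      ≤⟨ *-monoʳ-≤ T L≤TΣ ⟩
  T * (T * Σc)                               ≡⟨ *-assoc T T Σc ⟨
  T * T * Σc                                 ≡⟨ ∑-*ˡ T (T * T) (λ d → cnt (meet (suc d) g) L) ⟨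
  ∑ T (λ d → T * T * cnt (meet (suc d) g) L) ∎)
  where
  open ≤-Reasoning
  T Σc x : ℕ
  T  = suc (4 * q)
  Σc = ∑ T (λ d → cnt (meet (suc d) g) L)
  x  = suc (L / T)

  pairs : ∀ a ℓ → ℓ ≤ T → cnt (g ∘ (a +_)) ℓ ≤ 1 + ∑ ℓ (λ y → ∑ T (λ d → ⟦ meet (suc d) g (a + y) ⟧))
  pairs a ℓ ℓ≤T = ≤-trans (cnt-≤-pairs (g ∘ (a +_)) T ℓ ℓ≤T)
    (≤-reflexive (cong suc (∑-cong ℓ λ y → ∑-cong T λ d →
      cong (λ z → ⟦ g (a + y) ∧ g z ⟧) (sym (+-assoc a y (suc d))))))

  few : cnt g L ≤ x + Σc
  few = begin
    cnt g L                                                 ≤⟨ ∑-tile T 1 pairs x L (≤-suc-/ L T) ⟩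
    x * 1 + ∑ L (λ y → ∑ T (λ d → ⟦ meet (suc d) g y ⟧))    ≡⟨ cong₂ _+_ (*-identityʳ x) (∑-swap L T (λ y d → ⟦ meet (suc d) g y ⟧)) ⟩
    x + Σc                                                  ∎

  L≤TΣ : L ≤ T * Σc
  L≤TΣ = *-cancelˡ-≤ 2 (+-cancelˡ-≤ (2 * L) _ _ (begin
    2 * L + 2 * L            ≡⟨ four L ⟩
    4 * L                    ≤⟨ *-monoʳ-≤ 4 dense ⟩
    4 * (q * cnt g L)        ≡⟨ *-assoc 4 q _ ⟨
    4 * q * cnt g L          ≤⟨ *-monoˡ-≤ (cnt g L) (n≤1+n (4 * q)) ⟩
    T * cnt g L              ≤⟨ *-monoʳ-≤ T few ⟩
    T * (x + Σc)             ≡⟨ expand T (L / T) Σc ⟩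
    T + L / T * T + T * Σc   ≤⟨ +-monoˡ-≤ _ (+-mono-≤ T≤L (m/n*n≤m L T)) ⟩
    L + L + T * Σc           ≤⟨ +-mono-≤ (≤-reflexive (two L)) (m≤n*m (T * Σc) 2) ⟩
    2 * L + 2 * (T * Σc)     ∎))
    where
    four : ∀ L → 2 * L + 2 * L ≡ 4 * L
    four = solve-∀
    two : ∀ L → L + L ≡ 2 * L
    two = solve-∀
    expand : ∀ T y s → T * (suc y + s) ≡ T + y * T + T * s
    expand = solve-∀

-- The steps are bounded in terms of the density and the dimension alone.
cube-lemma : ∀ k q → ∃[ T ] ∃[ L₀ ] (∀ L g → L₀ ≤ L → L ≤ q * cnt g L →
  ∃[ ds ] ∃[ a ] (length ds ≡ k × All (λ d → 1 ≤ d × d ≤ T) ds × a < L × cube g ds a))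
cube-lemma zero q = 0 , 1 , base
  where
  base : ∀ L g → 1 ≤ L → L ≤ q * cnt g L → ∃[ ds ] ∃[ a ] (length ds ≡ 0 × All (λ d → 1 ≤ d × d ≤ 0) ds × a < L × cube g ds a)
  base L g 1≤L dense with a , a<L , ga ← cnt-witness g L (n≢0⇒n>0 λ cnt≡0 →
         <⇒≱ 1≤L (≤-trans dense (≤-reflexive (trans (cong (q *_) cnt≡0) (*-zeroʳ q)))))
    = [] , a , refl , [] , a<L , ga
cube-lemma (suc k) q
  -- Intersecting with a translate lowers the density from `1/q` to `1/(4q+1)²`, a loss independent
  -- of `L`.
  with T , L₀ , ih ← cube-lemma k (suc (4 * q) * suc (4 * q))
  = suc (4 * q) + T , suc (4 * q) + L₀ , step
  where
  step : ∀ L g → suc (4 * q) + L₀ ≤ L → L ≤ q * cnt g L →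
    ∃[ ds ] ∃[ a ] (length ds ≡ suc k × All (λ d → 1 ≤ d × d ≤ suc (4 * q) + T) ds × a < L × cube g ds a)
  step L g L≥ dense
    with d , d≤ , dense′ ← popular-difference q L g (m+n≤o⇒m≤o _ L≥) dense
    with ds , a , len , bounds , a<L , c ← ih L (meet (suc d) g) (m+n≤o⇒n≤o (suc (4 * q)) L≥) dense′
    = suc d ∷ ds , a , cong suc len
    , (s≤s z≤n , ≤-trans (s≤s d≤) (m≤m+n _ T)) ∷ All.map (λ (1≤ , ≤T) → 1≤ , ≤-trans ≤T (m≤n+m T _)) bounds
    , a<L , cube-meet ds c

-- Progression-free sets and reflections

APFree : (ℕ → Bool) → Set
APFree f = ∀ a d → f a ≡ true → f (a + suc d) ≡ true → f (a + 2 * suc d) ≡ true → ⊥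

APFree-∘ : ∀ {f} → APFree f → ∀ b e → APFree (λ i → f (i * suc e + b))
APFree-∘ {f} free b e x d p q r = free (x * suc e + b) (e + d * suc e) p
  (subst (λ z → f z ≡ true) (eq₁ x d b e) q) (subst (λ z → f z ≡ true) (eq₂ x d b e) r)
  where
  eq₁ : ∀ x d b e → (x + suc d) * suc e + b ≡ x * suc e + b + suc (e + d * suc e)
  eq₁ = solve-∀
  eq₂ : ∀ x d b e → (x + 2 * suc d) * suc e + b ≡ x * suc e + b + 2 * suc (e + d * suc e)
  eq₂ = solve-∀

APFree-+ : ∀ {f} → APFree f → ∀ b → APFree (f ∘ (b +_))
APFree-+ {f} free b x d p q r = free (b + x) d p
  (subst (λ z → f z ≡ true) (sym (+-assoc b x _)) q) (subst (λ z → f z ≡ true) (sym (+-assoc b x _)) r)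

-- The reversal `y ↦ f (L − 1 − y)` on [0, L), extended by `false`.
mirror : (ℕ → Bool) → ℕ → ℕ → Bool
mirror f zero    _       = false
mirror f (suc L) zero    = f L
mirror f (suc L) (suc y) = mirror f L y

cnt-mirror : ∀ f L → cnt (mirror f L) L ≡ cnt f L
cnt-mirror f zero    = refl
cnt-mirror f (suc L) = begin
  ⟦ f L ⟧ + cnt (mirror f L) L ≡⟨ cong (⟦ f L ⟧ +_) (cnt-mirror f L) ⟩
  ⟦ f L ⟧ + cnt f L            ≡⟨ +-comm ⟦ f L ⟧ _ ⟩
  cnt f L + ⟦ f L ⟧            ≡⟨ ∑-suc L (⟦_⟧ ∘ f) ⟨
  cnt f (suc L)                ∎
  where open ≡-Reasoning

mirror-true : ∀ f L y → mirror f L y ≡ true → ∃[ s ] (f s ≡ true × y + suc s ≡ L)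
mirror-true f (suc L) zero    p = L , p , refl
mirror-true f (suc L) (suc y) p with s , fs , eq ← mirror-true f L y p = s , fs , cong suc eq

delay : ℕ → (ℕ → Bool) → ℕ → Bool
delay zero    N y       = N y
delay (suc δ) N zero    = false
delay (suc δ) N (suc y) = delay δ N y

delay-+ : ∀ δ N y → delay δ N (δ + y) ≡ N y
delay-+ zero    N y = refl
delay-+ (suc δ) N y = delay-+ δ N y

delay-true : ∀ δ N y → delay δ N y ≡ true → ∃[ x ] (N x ≡ true × y ≡ δ + x)
delay-true zero    N y       p = y , p , refl
delay-true (suc δ) N (suc y) p with x , Nx , eq ← delay-true δ N y p = x , Nx , cong suc eq

grow : ℕ → (ℕ → Bool) → ℕ → Bool
grow δ N y = N y ∨ delay δ N y

exit : ℕ → (ℕ → Bool) → ℕ → Bool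
exit δ N y = N y ∧ not (N (δ + y))

-- The new elements of `grow δ N` are the translates by `δ` of the exits, and at most `δ` positions
-- are pushed beyond `L`.
cnt-grow : ∀ δ N L → cnt N L + cnt (exit δ N) L ≤ cnt (grow δ N) L + δ
cnt-grow δ N L = begin
  cnt N L + cnt (exit δ N) L                                    ≤⟨ +-monoˡ-≤ _ (∑-monoˡ _ (m≤n+m L δ)) ⟩
  cnt N (δ + L) + cnt (exit δ N) L                              ≡⟨ cong (_+ cnt (exit δ N) L) (cnt-split N δ L) ⟩
  cnt N δ + cnt (N ∘ (δ +_)) L + cnt (exit δ N) L               ≡⟨ +-assoc (cnt N δ) _ _ ⟩
  cnt N δ + (cnt (N ∘ (δ +_)) L + cnt (exit δ N) L)             ≡⟨ cong (cnt N δ +_) (∑-+ L _ _) ⟨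
  cnt N δ + ∑ L (λ y → ⟦ N (δ + y) ⟧ + ⟦ exit δ N y ⟧)          ≤⟨ +-mono-≤ (∑-mono δ λ y → ∨-≤ (N y) _)
                                                                     (∑-mono L λ y → ≤-reflexive (point (N (δ + y)) (delay-+ δ N y))) ⟩
  cnt (grow δ N) δ + cnt (grow δ N ∘ (δ +_)) L                  ≡⟨ cnt-split (grow δ N) δ L ⟨
  cnt (grow δ N) (δ + L)                                        ≤⟨ cnt-+-≤ (grow δ N) δ L ⟩
  cnt (grow δ N) L + δ                                          ∎
  where
  open ≤-Reasoning
  ∨-≤ : ∀ x y → ⟦ x ⟧ ≤ ⟦ x ∨ y ⟧
  ∨-≤ true  y = ≤-refl
  ∨-≤ false y = z≤n
  point : ∀ x {y z} → y ≡ z → ⟦ x ⟧ + ⟦ z ∧ not x ⟧ ≡ ⟦ x ∨ y ⟧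
  point true  {true}  refl = refl
  point true  {false} refl = refl
  point false {true}  refl = refl
  point false {false} refl = refl

-- Reflected f w ds N: every y ∈ N is such that w + y is the mirror image of some
-- s ∈ f in a point m > s at which the remaining cube is based.
Reflected : (ℕ → Bool) → ℕ → List ℕ → (ℕ → Bool) → Set
Reflected f w ds N = ∀ y → N y ≡ true →
  ∃[ s ] ∃[ m ] (f s ≡ true × s < m × cube f ds m × w + y + s ≡ m + m)

-- The image of `s < L` in the point `L + x` is `2 (L + x) − s`, that is, the window origin
-- `L + 2 x + 1` plus the reversed position `L − 1 − s`.
mirror-Reflected : ∀ {f L x} ds → cube f ds (L + x) → Reflected f (suc (L + 2 * x)) ds (mirror f L)
mirror-Reflected {f} {L} {x} ds c y p with s , fs , eq ← mirror-true f L y p =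
  s , L + x , fs , ≤-trans (≤-trans (m≤n+m (suc s) y) (≤-reflexive eq)) (m≤m+n L x)
  , c , trans (eq₁ L x y s) (trans (cong (L + 2 * x +_) eq) (eq₂ L x))
  where
  eq₁ : ∀ L x y s → suc (L + 2 * x) + y + s ≡ L + 2 * x + (y + suc s)
  eq₁ = solve-∀
  eq₂ : ∀ L x → L + 2 * x + L ≡ L + x + (L + x)
  eq₂ = solve-∀

-- Moving the centre from `m` to `m + d` moves the mirror image by `2 d`: old points keep the lower
-- half of the cube, new ones take the upper half.
Reflected-grow : ∀ {f w d ds N} → Reflected f w (d ∷ ds) N → Reflected f w ds (grow (2 * d) N)
Reflected-grow {f} {w} {d} {ds} {N} refl′ y p with N y in Ny
... | true  with s , m , fs , s<m , (c , _) , eq ← refl′ y Ny = s , m , fs , s<m , c , eq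
... | false with x , Nx , refl ← delay-true (2 * d) N y p
            with s , m , fs , s<m , (_ , c) , eq ← refl′ x Nx
  = s , m + d , fs , ≤-trans s<m (m≤m+n m d) , c
  , trans (eq₁ w d x s) (trans (cong (2 * d +_) eq) (eq₂ d m))
  where
  eq₁ : ∀ w d x s → w + (2 * d + x) + s ≡ 2 * d + (w + x + s)
  eq₁ = solve-∀
  eq₂ : ∀ d m → 2 * d + (m + m) ≡ m + d + (m + d)
  eq₂ = solve-∀

-- `s`, `m` and the image `w + y` form a progression whose first two terms lie in `f`; `s < m` makes
-- its difference positive.
Reflected-disjoint : ∀ {f w ds N} → APFree f → Reflected f w ds N → ∀ y → N y ≡ true → f (w + y) ≡ false
Reflected-disjoint {f} {w} {ds} free refl′ y Ny with f (w + y) in fp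
... | false = refl
... | true with s , m , fs , s<m , c , eq ← refl′ y Ny
           with d , refl ← m≤n⇒∃[o]m+o≡n s<m
  = ⊥-elim (free s d fs (subst (λ z → f z ≡ true) (sym (+-suc s d)) (cube-base ds c))
      (subst (λ z → f z ≡ true) (+-cancelʳ-≡ s _ _ (trans eq (double s d))) fp))
  where
  double : ∀ s d → suc (s + d) + suc (s + d) ≡ s + 2 * suc d + s
  double = solve-∀

-- A stage with more than `g + 2 T` exits gains at least `g` points when grown, even after the
-- boundary loss of `2 d`. The last hypothesis says that [0, L) has no room for this at every step.
stable-stage : ∀ {f w} → APFree f → ∀ T g L ds N → All (λ d → 1 ≤ d × d ≤ T) ds → Reflected f w ds N →
  L < cnt N L + length ds * g →
  ∃[ N′ ] ∃[ d ] (1 ≤ d × d ≤ T × (∀ y → N′ y ≡ true → f (w + y) ≡ false) ×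
                  cnt N L ≤ cnt N′ L × cnt (exit (2 * d) N′) L ≤ g + 2 * T)
stable-stage free T g L [] N [] r big =
  contradiction (≤-trans big (≤-trans (≤-reflexive (+-identityʳ _)) (cnt≤ N L))) (<-irrefl refl)
stable-stage {f} {w} free T g L (d ∷ ds) N ((1≤d , d≤T) ∷ bounds) r big
  with cnt (exit (2 * d) N) L ≤? g + 2 * T
... | yes few = N , d , 1≤d , d≤T , Reflected-disjoint {ds = d ∷ ds} free r , ≤-refl , few
... | no many =
  let N′ , d′ , 1≤d′ , d′≤T , disj , N≤N′ , few =
        stable-stage {f} {w} free T g L ds (grow (2 * d) N) bounds (Reflected-grow {f} {w} {d} {ds} {N} r) big′
  in  N′ , d′ , 1≤d′ , d′≤T , disj , ≤-trans (≤-trans (m≤m+n _ g) grown) N≤N′ , few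
  where
  open ≤-Reasoning
  grown : cnt N L + g ≤ cnt (grow (2 * d) N) L
  grown = +-cancelʳ-≤ (2 * d) _ _ (begin
    cnt N L + g + 2 * d               ≡⟨ +-assoc (cnt N L) g _ ⟩
    cnt N L + (g + 2 * d)             ≤⟨ +-monoʳ-≤ (cnt N L) (+-monoʳ-≤ g (*-monoʳ-≤ 2 d≤T)) ⟩
    cnt N L + (g + 2 * T)             ≤⟨ +-monoʳ-≤ (cnt N L) (≰⇒≥ many) ⟩
    cnt N L + cnt (exit (2 * d) N) L  ≤⟨ cnt-grow (2 * d) N L ⟩
    cnt (grow (2 * d) N) L + 2 * d    ∎)
  big′ : L < cnt (grow (2 * d) N) L + length ds * g
  big′ = begin-strict
    L                                          <⟨ big ⟩
    cnt N L + (g + length ds * g)              ≡⟨ +-assoc (cnt N L) g _ ⟨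
    cnt N L + g + length ds * g                ≤⟨ +-monoˡ-≤ _ grown ⟩
    cnt (grow (2 * d) N) L + length ds * g     ∎

-- Density on the complement of an almost invariant set

module _ (δ : ℕ) {N S : ℕ → Bool} (disjoint : ∀ y → N y ≡ true → S y ≡ false) where

  private
    shift : ∀ (f : ℕ → Bool) n y → ∑ n (λ i → ⟦ f (i * δ + (δ + y)) ⟧) ≡ ∑ n (λ i → ⟦ f (suc i * δ + y) ⟧)
    shift f n y = ∑-cong n λ i → cong (⟦_⟧ ∘ f) (eq i δ y)
      where
      eq : ∀ i δ y → i * δ + (δ + y) ≡ δ + i * δ + y
      eq = solve-∀

  -- A progression starting in N meets the complement of N only after leaving N.
  progression-from-N : ∀ n y → N y ≡ true →
    ∑ n (λ i → ⟦ S (i * δ + y) ⟧) ≤ n * ∑ n (λ i → ⟦ exit δ N (i * δ + y) ⟧)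
  progression-from-N zero    y Ny = z≤n
  progression-from-N (suc n) y Ny rewrite disjoint y Ny | Ny with N (δ + y) in Nδy
  ... | true  = begin
    ∑ n (λ i → ⟦ S (suc i * δ + y) ⟧)                       ≡⟨ shift S n y ⟨
    ∑ n (λ i → ⟦ S (i * δ + (δ + y)) ⟧)                     ≤⟨ progression-from-N n (δ + y) Nδy ⟩
    n * ∑ n (λ i → ⟦ exit δ N (i * δ + (δ + y)) ⟧)          ≡⟨ cong (n *_) (shift (exit δ N) n y) ⟩
    n * ∑ n (λ i → ⟦ exit δ N (suc i * δ + y) ⟧)            ≤⟨ *-monoˡ-≤ _ (n≤1+n n) ⟩
    suc n * ∑ n (λ i → ⟦ exit δ N (suc i * δ + y) ⟧)        ∎
    where open ≤-Reasoning
  ... | false = ≤-trans (cnt≤ _ n) (≤-trans (n≤1+n n) (m≤m*n (suc n) _))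

  -- Progressions starting outside `N` are charged to the assumed density, those starting in `N` to
  -- their exits; adding both charges gives a bound that can be summed over `y`.
  progression-bound : ∀ {E c} n y → E * ∑ n (λ i → ⟦ S (i * δ + y) ⟧) ≤ c * n →
    E * ∑ n (λ i → ⟦ S (i * δ + y) ⟧) ≤ c * n * ⟦ not (N y) ⟧ + E * n * ∑ n (λ i → ⟦ exit δ N (i * δ + y) ⟧)
  progression-bound {E} {c} n y dense with N y in Ny
  ... | true  = ≤-trans (*-monoʳ-≤ E (progression-from-N n y Ny))
                        (≤-trans (≤-reflexive (sym (*-assoc E n _))) (m≤n+m _ (c * n * 0)))
  ... | false = ≤-trans dense (≤-trans (≤-reflexive (sym (*-identityʳ (c * n)))) (m≤m+n _ _))

  -- Double counting over the progressions of length `n` and difference `δ` from each `y < L`: each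
  -- of the `n` shifts by `i δ` alters a count on [0, L) by at most `n δ`.
  density-off-N : ∀ {E c} n L .{{_ : NonZero n}} →
    (∀ y → E * ∑ n (λ i → ⟦ S (i * δ + y) ⟧) ≤ c * n) →
    E * cnt S L ≤ c * cnt (not ∘ N) L + E * n * (cnt (exit δ N) L + n * δ) + E * (n * δ)
  density-off-N {E} {c} n L dense = *-cancelˡ-≤ n (begin
    n * (E * cnt S L)                                                ≡⟨ trans (x∙yz n E _) (cong (E *_) (sym (∑-const n _))) ⟩
    E * ∑ n (λ _ → cnt S L)                                          ≤⟨ *-monoʳ-≤ E (∑-mono-< n (λ i i<n → ≤-trans (cnt-≤-shift S (i * δ) L)
                                                                          (+-monoʳ-≤ _ (*-monoˡ-≤ δ (<⇒≤ i<n))))) ⟩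
    E * ∑ n (λ i → cnt (S ∘ (i * δ +_)) L + n * δ)                   ≡⟨ cong (E *_) (trans (∑-+ n _ _) (cong₂ _+_ (∑-swap n L _) (∑-const n _))) ⟩
    E * (∑ L (λ y → ∑ n (λ i → ⟦ S (i * δ + y) ⟧)) + n * (n * δ))    ≡⟨ *-distribˡ-+ E _ _ ⟩
    E * ∑ L (λ y → ∑ n (λ i → ⟦ S (i * δ + y) ⟧)) + E * (n * (n * δ)) ≡⟨ cong (_+ E * (n * (n * δ))) (∑-*ˡ L E _) ⟨
    ∑ L (λ y → E * ∑ n (λ i → ⟦ S (i * δ + y) ⟧)) + E * (n * (n * δ)) ≤⟨ +-monoˡ-≤ _ (∑-mono L λ y → progression-bound {E} {c} n y (dense y)) ⟩
    ∑ L (λ y → c * n * ⟦ not (N y) ⟧ + E * n * ∑ n (λ i → ⟦ exit δ N (i * δ + y) ⟧)) + E * (n * (n * δ))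
      ≡⟨ cong (_+ E * (n * (n * δ))) (trans (∑-+ L _ _) (cong₂ _+_ (∑-*ˡ L (c * n) _) (trans (∑-*ˡ L (E * n) _) (cong (E * n *_) (∑-swap L n _))))) ⟩
    c * n * cnt (not ∘ N) L + E * n * ∑ n (λ i → cnt (exit δ N ∘ (i * δ +_)) L) + E * (n * (n * δ))
      ≤⟨ +-monoˡ-≤ _ (+-monoʳ-≤ (c * n * cnt (not ∘ N) L) (*-monoʳ-≤ (E * n) (∑-mono-< n (λ i i<n → ≤-trans (cnt-shift-≤ (exit δ N) (i * δ) L)
           (+-monoʳ-≤ _ (*-monoˡ-≤ δ (<⇒≤ i<n))))))) ⟩
    c * n * cnt (not ∘ N) L + E * n * ∑ n (λ _ → X) + E * (n * (n * δ))
      ≡⟨ cong (λ z → c * n * cnt (not ∘ N) L + E * n * z + E * (n * (n * δ))) (∑-const n X) ⟩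
    c * n * cnt (not ∘ N) L + E * n * (n * X) + E * (n * (n * δ))    ≡⟨ factor c n (cnt (not ∘ N) L) E X δ ⟩
    n * (c * cnt (not ∘ N) L + E * n * X + E * (n * δ))              ∎)
    where
    open ≤-Reasoning
    X : ℕ
    X = cnt (exit δ N) L + n * δ
    x∙yz : ∀ a b c → a * (b * c) ≡ b * (a * c)
    x∙yz = solve-∀
    factor : ∀ c n a E X δ → c * n * a + E * n * (n * X) + E * (n * (n * δ)) ≡ n * (c * a + E * n * X + E * (n * δ))
    factor = solve-∀

-- Roth's theorem

-- Since `APFree` is preserved by translation and dilation, a bound on [0, n) holds on every
-- progression of length `n`.
DensityBound : ℕ → ℕ → ℕ → Set
DensityBound E c n = ∀ f → APFree f → E * cnt f n ≤ c * n

blocks-bound : ∀ {E c n} → DensityBound E c n →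
               ∀ f → APFree f → ∀ x L → L ≤ x * n → E * cnt f L ≤ x * (c * n)
blocks-bound {E} {c} {n} bound f free x L L≤ = begin
  E * cnt f L                  ≡⟨ ∑-*ˡ L E _ ⟨
  ∑ L (λ i → E * ⟦ f i ⟧)      ≤⟨ ∑-tile n (c * n) {v = λ _ → 0} tile x L L≤ ⟩
  x * (c * n) + ∑ L (λ _ → 0)  ≡⟨ cong (x * (c * n) +_) (trans (∑-const L 0) (*-zeroʳ L)) ⟩
  x * (c * n) + 0              ≡⟨ +-identityʳ _ ⟩
  x * (c * n)                  ∎
  where
  open ≤-Reasoning
  tile : ∀ a m → m ≤ n → ∑ m (λ i → E * ⟦ f (a + i) ⟧) ≤ c * n + ∑ m (λ _ → 0)
  tile a m m≤n = begin
    ∑ m (λ i → E * ⟦ f (a + i) ⟧)  ≤⟨ ∑-monoˡ _ m≤n ⟩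
    ∑ n (λ i → E * ⟦ f (a + i) ⟧)  ≡⟨ ∑-*ˡ n E _ ⟩
    E * cnt (f ∘ (a +_)) n         ≤⟨ bound _ (APFree-+ free a) ⟩
    c * n                          ≤⟨ m≤m+n _ _ ⟩
    c * n + ∑ m (λ _ → 0)          ∎

interval-bound : ∀ {E c n} .{{_ : NonZero n}} → DensityBound E c n →
                 ∀ f → APFree f → ∀ ℓ → E * cnt f ℓ ≤ c * (ℓ + n)
interval-bound {E} {c} {n} bound f free ℓ = begin
  E * cnt f ℓ                ≤⟨ blocks-bound {E} {c} bound f free (suc (ℓ / n)) ℓ (≤-suc-/ ℓ n) ⟩
  suc (ℓ / n) * (c * n)      ≡⟨ rearrange (ℓ / n) c n ⟩
  c * (ℓ / n * n + n)        ≤⟨ *-monoʳ-≤ c (+-monoˡ-≤ n (m/n*n≤m ℓ n)) ⟩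
  c * (ℓ + n)                ∎
  where
  open ≤-Reasoning
  rearrange : ∀ y c n → suc y * (c * n) ≡ c * (y * n + n)
  rearrange = solve-∀

-- Outside the subinterval the density is at most `(j + 1)/E` up to rounding, so the subinterval
-- carries no more than the total deficit `4 L / E` and two rounding terms.
subinterval-dense : ∀ {E j n} .{{_ : NonZero n}} → DensityBound E (suc j) n →
  ∀ f → APFree f → ∀ L → j * (4 * L) < E * cnt f (4 * L) →
  ∀ a r → a + (L + r) ≡ 4 * L →
  suc j * L ≤ E * cnt (f ∘ (a +_)) L + 4 * L + 2 * (suc j * n)
subinterval-dense {E} {j} {n} bound f free L dense a r eq =
  ≤-by 0 (+-mono-≤ (<⇒≤ dense′) (+-mono-≤ (interval-bound {E} {suc j} bound f free a)
                                  (interval-bound {E} {suc j} bound _ (APFree-+ (APFree-+ free a) L) r)))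
    (trans (ident E j L n a r X Y Z) (cong (λ z → E * Y + z + 2 * (suc j * n) + (j * z + (E * X + E * Z))) eq))
  where
  X Y Z : ℕ
  X = cnt f a
  Y = cnt (f ∘ (a +_)) L
  Z = cnt (f ∘ (a +_) ∘ (L +_)) r
  dense′ : j * (4 * L) < E * (X + (Y + Z))
  dense′ = subst (λ z → j * (4 * L) < E * z)
    (trans (cong (cnt f) (sym eq)) (trans (cnt-split f a (L + r)) (cong (X +_) (cnt-split _ L r)))) dense
  ident : ∀ E j L n a r X Y Z →
    suc j * L + (E * (X + (Y + Z)) + (suc j * (a + n) + suc j * (r + n))) + 0 ≡
    E * Y + (a + (L + r)) + 2 * (suc j * n) + (j * (a + (L + r)) + (E * X + E * Z))
  ident = solve-∀

-- The complement of N has density about 1 − c/E in the window and carries S with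
-- relative density at most c/E, so (c/E)² is bounded by the error terms.
energy-bound : ∀ {E c n L T e d} {F S P Q X : ℕ} → c ≤ E → d ≤ T → X ≤ e →
  c * L ≤ E * F + 4 * L + 2 * (c * n) →
  c * L ≤ E * S + 4 * L + 2 * (c * n) →
  F ≤ P → Q + P ≡ L →
  E * S ≤ c * Q + E * n * (X + n * (2 * d)) + E * (n * (2 * d)) →
  c * c * L ≤ 8 * (E * L) + E * E * n * (4 + (e + 2 * T * n + 2 * T))
energy-bound {E} {c} {n} {L} {T} {e} {d} {F} {S} {P} {Q} {X} c≤E d≤T X≤e hF hS F≤P refl hQ = begin
  c * c * L
    ≤⟨ ≤-by 0 (+-mono-≤ (*-monoʳ-≤ c hF) (+-mono-≤ (*-monoʳ-≤ E hS) (+-mono-≤ (*-monoʳ-≤ E hQ′) (*-monoʳ-≤ (c * E) F≤P))))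
         (ident₁ E c n T e F S P Q) ⟩
  4 * (c * L + E * L) + (2 * (c * c * n) + 2 * (E * c * n)) + R
    ≤⟨ +-monoˡ-≤ R (+-mono-≤ (*-monoʳ-≤ 4 (+-monoˡ-≤ (E * L) (*-monoˡ-≤ L c≤E)))
         (+-mono-≤ (*-monoʳ-≤ 2 (*-monoˡ-≤ n (*-mono-≤ c≤E c≤E))) (*-monoʳ-≤ 2 (*-monoˡ-≤ n (*-monoʳ-≤ E c≤E))))) ⟩
  4 * (E * L + E * L) + (2 * (E * E * n) + 2 * (E * E * n)) + R
    ≡⟨ ident₂ E n T e L ⟩
  8 * (E * L) + E * E * n * (4 + (e + 2 * T * n + 2 * T)) ∎
  where
  open ≤-Reasoning
  R : ℕ
  R = E * (E * n * (e + n * (2 * T)) + E * (n * (2 * T)))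
  hQ′ : E * S ≤ c * Q + E * n * (e + n * (2 * T)) + E * (n * (2 * T))
  hQ′ = ≤-trans hQ (+-mono-≤ (+-monoʳ-≤ (c * Q) (*-monoʳ-≤ (E * n) (+-mono-≤ X≤e nd≤nT))) (*-monoʳ-≤ E nd≤nT))
    where nd≤nT = *-monoʳ-≤ n (*-monoʳ-≤ 2 d≤T)
  ident₁ : ∀ E c n T e F S P Q →
    c * c * (Q + P) + (c * (E * F + 4 * (Q + P) + 2 * (c * n)) + (E * (E * S + 4 * (Q + P) + 2 * (c * n)) +
      (E * (c * Q + E * n * (e + n * (2 * T)) + E * (n * (2 * T))) + c * E * P))) + 0 ≡
    4 * (c * (Q + P) + E * (Q + P)) + (2 * (c * c * n) + 2 * (E * c * n)) +
      E * (E * n * (e + n * (2 * T)) + E * (n * (2 * T))) +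
      (c * (c * (Q + P)) + (E * (c * (Q + P)) + (E * (E * S) + c * E * F)))
  ident₁ = solve-∀
  ident₂ : ∀ E n T e L →
    4 * (E * L + E * L) + (2 * (E * E * n) + 2 * (E * E * n)) +
      E * (E * n * (e + n * (2 * T)) + E * (n * (2 * T))) ≡
    8 * (E * L) + E * E * n * (4 + (e + 2 * T * n + 2 * T))
  ident₂ = solve-∀

-- The set on [0, L) is reflected in a cube based in [L, 2L), and the images are counted in the
-- window of length `L` from `L + 2 x + 1`, still inside [0, 4L). By `subinterval-dense` the set is
-- dense both on [0, L) and in the window, which `energy-bound` makes impossible.
no-dense-set : ∀ {E j n L T g k} .{{_ : NonZero n}} →
  DensityBound E (suc j) n → suc j ≤ E → 10 ≤ suc j → 4 * n ≤ L →
  (∀ h → L ≤ E * cnt h L →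
    ∃[ ds ] ∃[ x ] (length ds ≡ k × All (λ d → 1 ≤ d × d ≤ T) ds × x < L × cube h ds x)) →
  L < k * g →
  8 * (E * L) + E * E * n * (4 + (g + 2 * T + 2 * T * n + 2 * T)) < suc j * suc j * L →
  DensityBound E j (4 * L)
no-dense-set {E} {j} {n} {L} {T} {g} {k} bound c≤E 10≤c 4n≤L cubes L<kg energetic f free
  with E * cnt f (4 * L) ≤? j * (4 * L)
... | yes sparse = sparse
... | no  ¬sparse =
  let ds , x , len , bounds , x<L , cub =
        cubes (f ∘ (L +_)) (L≤E*dense (dense-at L (2 * L) (four L)))
  in  ⊥-elim (reflect ds x len bounds x<L cub)
  where
  c : ℕ
  c = suc j

  dense-at : ∀ a r → a + (L + r) ≡ 4 * L → c * L ≤ E * cnt (f ∘ (a +_)) L + 4 * L + 2 * (c * n)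
  dense-at = subinterval-dense {E} {j} bound f free L (≰⇒> ¬sparse)

  four : ∀ L → L + (L + 2 * L) ≡ 4 * L
  four = solve-∀

  -- Double the bound: `4 c n ≤ c L` absorbs the rounding, and `c ≥ 10` leaves `(c − 8) L ≥ 2 L`.
  L≤E*dense : ∀ {F} → c * L ≤ E * F + 4 * L + 2 * (c * n) → L ≤ E * F
  L≤E*dense {F} h = *-cancelˡ-≤ 2 (≤-by 0
    (+-mono-≤ (*-monoʳ-≤ 2 h) (+-mono-≤ (*-monoˡ-≤ L 10≤c) (*-monoʳ-≤ c 4n≤L)))
    (ident c L n (E * F)))
    where
    ident : ∀ c L n z → 2 * L + (2 * (z + 4 * L + 2 * (c * n)) + (c * L + c * L)) + 0 ≡
                        2 * z + (2 * (c * L) + (10 * L + c * (4 * n)))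
    ident = solve-∀

  window : ∀ x v → suc (x + v) ≡ L → suc (L + 2 * x) + (L + suc (2 * v)) ≡ 4 * L
  window x v eq = trans (ident L x v) (trans (cong (λ z → 2 * L + 2 * z) eq) (ident′ L))
    where
    ident : ∀ L x v → suc (L + 2 * x) + (L + suc (2 * v)) ≡ 2 * L + 2 * suc (x + v)
    ident = solve-∀
    ident′ : ∀ L → 2 * L + 2 * L ≡ 4 * L
    ident′ = solve-∀

  reflect : ∀ ds x → length ds ≡ k → All (λ d → 1 ≤ d × d ≤ T) ds → x < L → cube (f ∘ (L +_)) ds x → ⊥
  reflect ds x len bounds x<L cub
    with v , x+v≡L ← m≤n⇒∃[o]m+o≡n x<L
    with N , suc d , _ , d≤T , disjoint , grown , few ←
           stable-stage {f} {suc (L + 2 * x)} free T g L ds (mirror f L) bounds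
             (mirror-Reflected {f} {L} {x} ds (cube-shift L ds cub))
             (≤-trans L<kg (≤-trans (≤-reflexive (cong (_* g) (sym len))) (m≤n+m _ _)))
    = <⇒≱ energetic (energy-bound {E} {c} {n} {L} {T} {g + 2 * T} {suc d} c≤E d≤T few
        (dense-at 0 (3 * L) refl) (dense-at w (suc (2 * v)) (window x v x+v≡L))
        (≤-trans (≤-reflexive (sym (cnt-mirror f L))) grown) (cnt-not N L)
        (density-off-N (2 * suc d) {N} {f ∘ (w +_)} disjoint {E} {c} n L λ y →
           -- The last argument is the predecessor of `2 * suc d`, as `APFree-∘` takes differences
           -- in successor form.
           bound _ (APFree-∘ (APFree-+ free w) y (d + (suc d + 0)))))
    where
    w : ℕ
    w = suc (L + 2 * x)

-- With `L = G * (g + 2 * T)`, a cube of dimension `2 G` offers more than `L / g` stages.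
many-stages : ∀ G T g .{{_ : NonZero G}} → 2 * T < g → G * (g + 2 * T) < 2 * G * g
many-stages G T g 2T<g = begin-strict
  G * (g + 2 * T) <⟨ *-monoʳ-< G (+-monoʳ-< g 2T<g) ⟩
  G * (g + g)     ≡⟨ ident G g ⟩
  2 * G * g       ∎
  where
  open ≤-Reasoning
  ident : ∀ G g → G * (g + g) ≡ 2 * G * g
  ident = solve-∀

-- `H` stands for `E * E * n`. The choice of `L` keeps the error terms below `L`, and `8 E + K = K²`
-- because `E = K D` and `K = 8 D + 1`.
errors-small : ∀ D K E H L T g n c .{{_ : NonZero H}} → K ≡ suc (8 * D) → E ≡ K * D → K ≤ c →
  L ≡ 2 * H * (g + 2 * T) → 5 + (2 * T * n + 2 * T) ≤ g →
  8 * (E * L) + H * (4 + (g + 2 * T + 2 * T * n + 2 * T)) < c * c * L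
errors-small D K E H L T g n c refl refl K≤c refl g≥ = begin-strict
  8 * (E * L) + H * (4 + (e + 2 * T * n + 2 * T))  <⟨ +-monoʳ-< (8 * (E * L)) (*-monoʳ-< H small) ⟩
  8 * (E * L) + H * (e + e)                        ≡⟨ cong (8 * (E * L) +_) (ident H e) ⟩
  8 * (E * L) + L                                  ≤⟨ +-monoʳ-≤ (8 * (E * L)) (m≤n*m L K) ⟩
  8 * (E * L) + K * L                              ≡⟨ ident′ D L ⟩
  K * K * L                                        ≤⟨ *-monoˡ-≤ L (*-mono-≤ K≤c K≤c) ⟩
  c * c * L                                        ∎
  where
  open ≤-Reasoning
  e : ℕ
  e = g + 2 * T
  ident : ∀ H e → H * (e + e) ≡ 2 * H * e
  ident = solve-∀
  ident′ : ∀ D L → 8 * (suc (8 * D) * D * L) + suc (8 * D) * L ≡ suc (8 * D) * suc (8 * D) * L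
  ident′ = solve-∀
  slack : ∀ g a b → suc (4 + (g + b + a + b)) + g + b ≡ g + b + (g + b) + (5 + (a + b))
  slack = solve-∀
  small : 4 + (e + 2 * T * n + 2 * T) < e + e
  small = ≤-by (2 * T) g≥ (slack g (2 * T * n) (2 * T))

module _ (D : ℕ) .{{_ : NonZero D}} where

  -- With c ≥ K and E = K D, taking K > 8 D makes (c/E)² exceed the density loss 8/E.
  private
    K E : ℕ
    K = suc (8 * D)
    E = K * D

  density-decrement : ∀ j n .{{_ : NonZero n}} → K ≤ j → suc j ≤ E → DensityBound E (suc j) n →
                      ∃[ m ] (NonZero m × DensityBound E j m)
  density-decrement j n K≤j c≤E bound
    -- The dimension depends only on `E` and `n`. It is fixed first: the step bound `T` depends on
    -- it, and `g` and `L` depend on `T`.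
    with T , L₀ , cubes ← cube-lemma (2 * (2 * (E * E * n))) E
    = choose T L₀ cubes _ refl _ refl
    where
    H G : ℕ
    H = E * E * n
    G = 2 * H

    instance
      E≢0 : NonZero E
      E≢0 = m*n≢0 K D
      E*E≢0 : NonZero (E * E)
      E*E≢0 = m*n≢0 E E
      H≢0 : NonZero H
      H≢0 = m*n≢0 (E * E) n
      G≢0 : NonZero G
      G≢0 = m*n≢0 2 H

    10≤c : 10 ≤ suc j
    10≤c = s≤s (≤-trans (s≤s (*-monoʳ-≤ 8 (>-nonZero⁻¹ D))) K≤j)

    choose : ∀ T L₀ →
      (∀ L h → L₀ ≤ L → L ≤ E * cnt h L →
        ∃[ ds ] ∃[ x ] (length ds ≡ 2 * G × All (λ d → 1 ≤ d × d ≤ T) ds × x < L × cube h ds x)) →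
      -- `g` dominates the error terms, the threshold `L₀` and `4 n`; `L ≥ g` inherits the last two.
      ∀ g → g ≡ 5 + (2 * T * n + 2 * T) + L₀ + 4 * n →
      ∀ L → L ≡ G * (g + 2 * T) →
      ∃[ m ] (NonZero m × DensityBound E j m)
    choose T L₀ cubes g g≡ L L≡ = 4 * L , m*n≢0 4 L {{_}} {{L≢0}} ,
      no-dense-set {L = L} {T} {g} {2 * G} bound c≤E 10≤c (≤-trans 4n≤g g≤L) (λ h → cubes L h (≤-trans L₀≤g g≤L))
        (≤-trans (≤-reflexive (cong suc L≡)) (many-stages G T g (≤-trans (s≤s (≤-trans (m≤n+m (2 * T) (2 * T * n)) (m≤n+m _ 4))) err≤g)))
        (errors-small D K E H L T g n (suc j) refl refl (≤-trans K≤j (n≤1+n j)) L≡ err≤g)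
      where
      err≤g : 5 + (2 * T * n + 2 * T) ≤ g
      err≤g = ≤-trans (≤-trans (m≤m+n _ L₀) (m≤m+n _ (4 * n))) (≤-reflexive (sym g≡))
      L₀≤g : L₀ ≤ g
      L₀≤g = ≤-trans (≤-trans (m≤n+m L₀ (5 + (2 * T * n + 2 * T))) (m≤m+n _ (4 * n))) (≤-reflexive (sym g≡))
      4n≤g : 4 * n ≤ g
      4n≤g = ≤-trans (m≤n+m (4 * n) (5 + (2 * T * n + 2 * T) + L₀)) (≤-reflexive (sym g≡))
      g≤L : g ≤ L
      g≤L = ≤-trans (m≤m+n g (2 * T)) (≤-trans (m≤n*m _ G) (≤-reflexive (sym L≡)))
      L≢0 : NonZero L
      L≢0 = >-nonZero (≤-trans (s≤s z≤n) (≤-trans err≤g g≤L))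

  -- Each decrement lowers the numerator by one; the descent ends at `K / E = 1 / D`.
  roth-descent : ∀ i → K + i ≤ E → ∃[ n ] (NonZero n × DensityBound E (K + i) n) →
                 ∃[ n ] (NonZero n × DensityBound E K n)
  roth-descent zero    _ (n , n≢0 , bound) = n , n≢0 , subst (λ j → DensityBound E j n) (+-identityʳ K) bound
  roth-descent (suc i) K+i<E (n , n≢0 , bound) = roth-descent i (<⇒≤ K+i<E′)
    (density-decrement (K + i) n {{n≢0}} (m≤m+n K i) K+i<E′ (subst (λ j → DensityBound E j n) (+-suc K i) bound))
    where
    K+i<E′ : K + i < E
    K+i<E′ = subst (_≤ E) (+-suc K i) K+i<E

  roth : ∃[ n ] (NonZero n × DensityBound D 1 n)
  roth =
    -- The starting point is the trivial density `E / E` at length 1.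
    let n , n≢0 , bound = roth-descent (E ∸ K) (≤-reflexive K+[E∸K]≡E) (1 , _ , trivial)
    in  n , n≢0 , λ f free → *-cancelˡ-≤ K (≤-trans (≤-reflexive (sym (*-assoc K D _)))
          (≤-trans (bound f free) (*-monoʳ-≤ K (≤-reflexive (sym (*-identityˡ n))))))
    where
    K+[E∸K]≡E : K + (E ∸ K) ≡ E
    K+[E∸K]≡E = m+[n∸m]≡n (m≤m*n K D)
    trivial : DensityBound E (K + (E ∸ K)) 1
    trivial f _ = *-mono-≤ (≤-reflexive (sym K+[E∸K]≡E)) (cnt≤ f 1)

-- Counting sparse families

^-distribʳ-* : ∀ m n o → (m * n) ^ o ≡ m ^ o * n ^ o
^-distribʳ-* m n zero    = refl
^-distribʳ-* m n (suc o) rewrite ^-distribʳ-* m n o = interchange m n (m ^ o) (n ^ o)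
  where
  interchange : ∀ a b c d → a * b * (c * d) ≡ a * c * (b * d)
  interchange = solve-∀

^-swap : ∀ m n o → (m ^ n) ^ o ≡ (m ^ o) ^ n
^-swap m n o = trans (^-*-assoc m n o) (trans (cong (m ^_) (*-comm n o)) (sym (^-*-assoc m o n)))

^-cancelˡ-≤ : ∀ {m n} o .{{_ : NonZero o}} → m ^ o ≤ n ^ o → m ≤ n
^-cancelˡ-≤ o mᵒ≤nᵒ = ≮⇒≥ λ n<m → <⇒≱ (^-monoˡ-< o n<m) mᵒ≤nᵒ

module _ {A : Set} (b : A → ℕ → Bool) where

  Agree : ℕ → A → A → Set
  Agree n x y = ∀ i → i < n → b x i ≡ b y i

  Separated : ℕ → List A → Set
  Separated n = AllPairs (λ x y → ¬ Agree n x y)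

  part : Bool → ℕ → List A → List A
  part v n = filter (λ x → b x n ≟ᵇ v)

  Agree-suc : ∀ {n x y} → Agree n x y → b x n ≡ b y n → Agree (suc n) x y
  Agree-suc agree eq i i<1+n with m<1+n⇒m<n∨m≡n i<1+n
  ... | inj₁ i<n  = agree i i<n
  ... | inj₂ refl = eq

  separated-part : ∀ v n xs → Separated (suc n) xs → Separated n (part v n xs)
  separated-part v n []       []       = []
  separated-part v n (x ∷ xs) (p ∷ ps) with b x n ≟ᵇ v
  ... | no  _  = separated-part v n xs ps
  ... | yes eq = apart xs p ∷ separated-part v n xs ps
    where
    apart : ∀ ys → All (λ y → ¬ Agree (suc n) x y) ys → All (λ y → ¬ Agree n x y) (part v n ys)
    apart []       []       = []
    apart (y ∷ ys) (q ∷ qs) with b y n ≟ᵇ v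
    ... | no  _   = apart ys qs
    ... | yes eq′ = (λ agree → q (Agree-suc agree (trans eq (sym eq′)))) ∷ apart ys qs

  -- Over all 2ⁿ words of length n these weights sum to (t + 1)ⁿ.
  weight : ℕ → ℕ → A → ℕ
  weight t zero    x = 1
  weight t (suc n) x = (if b x n then 1 else t) * weight t n x

  total : ℕ → ℕ → List A → ℕ
  total t n xs = sum (map (weight t n) xs)

  total-suc : ∀ t n xs → total t (suc n) xs ≡ total t n (part true n xs) + t * total t n (part false n xs)
  total-suc t n []       = sym (*-zeroʳ t)
  total-suc t n (x ∷ xs) rewrite total-suc t n xs with b x n
  ... | true  = ident (weight t n x) (total t n (part true n xs)) _
    where
    ident : ∀ w p q → w + 0 + (p + q) ≡ w + p + q
    ident = solve-∀
  ... | false = ident t (weight t n x) (total t n (part true n xs)) (total t n (part false n xs))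
    where
    ident : ∀ t w p q → t * w + (p + t * q) ≡ p + t * (w + q)
    ident = solve-∀

  -- Splitting by bit `n` gives `(t + 1)ⁿ + t (t + 1)ⁿ`. At `n = 0` any two elements agree, so a
  -- separated list has at most one.
  total≤ : ∀ t n xs → Separated n xs → total t n xs ≤ suc t ^ n
  total≤ t zero    []           _                 = z≤n
  total≤ t zero    (x ∷ [])     _                 = ≤-refl
  total≤ t zero    (x ∷ y ∷ xs) ((¬agree ∷ _) ∷ _) = contradiction (λ i ()) ¬agree
  total≤ t (suc n) xs           sep               = begin
    total t (suc n) xs                                             ≡⟨ total-suc t n xs ⟩
    total t n (part true n xs) + t * total t n (part false n xs)   ≤⟨ +-mono-≤ (total≤ t n _ (separated-part true n xs sep))
                                                                       (*-monoʳ-≤ t (total≤ t n _ (separated-part false n xs sep))) ⟩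
    suc t ^ n + t * suc t ^ n                                      ∎
    where open ≤-Reasoning

  -- The weight is `t` to the number of zeros, so words with few ones are heavy.
  weight≥ : ∀ t n x → t ^ n ≤ t ^ cnt (b x) n * weight t n x
  weight≥ t zero    x = ≤-refl
  weight≥ t (suc n) x rewrite ∑-suc n (⟦_⟧ ∘ b x) with b x n
  ... | true  = ≤-trans (*-monoʳ-≤ t (weight≥ t n x))
                  (≤-reflexive (trans (ident t (t ^ cnt (b x) n) _) (cong (λ e → t ^ e * (weight t n x + 0)) (+-comm 1 (cnt (b x) n)))))
    where
    ident : ∀ t p w → t * (p * w) ≡ t * p * (w + 0)
    ident = solve-∀
  ... | false = ≤-trans (*-monoʳ-≤ t (weight≥ t n x))
                  (≤-reflexive (trans (ident t (t ^ cnt (b x) n) _) (cong (λ e → t ^ e * (t * weight t n x)) (sym (+-identityʳ (cnt (b x) n))))))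
    where
    ident : ∀ t p w → t * (p * w) ≡ p * (t * w)
    ident = solve-∀

  -- Each element weighs at least `t ^ (n − r)`, while the total is at most `(t + 1) ^ n`.
  length≤ : ∀ t n r xs .{{_ : NonZero t}} → Separated n xs → All (λ x → cnt (b x) n ≤ r) xs →
            length xs * t ^ n ≤ t ^ r * suc t ^ n
  length≤ t n r xs sep sparse = ≤-trans (go xs sparse) (*-monoʳ-≤ (t ^ r) (total≤ t n xs sep))
    where
    go : ∀ xs → All (λ x → cnt (b x) n ≤ r) xs → length xs * t ^ n ≤ t ^ r * total t n xs
    go []       []       = z≤n
    go (x ∷ xs) (p ∷ ps) = ≤-trans
      (+-mono-≤ (≤-trans (weight≥ t n x) (*-monoˡ-≤ (weight t n x) (^-monoʳ-≤ t p))) (go xs ps))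
      (≤-reflexive (sym (*-distribˡ-+ (t ^ r) _ _)))

-- A converse to Bernoulli's inequality: `(1 + 1/t) ^ i ≤ 1 + 2 i / t`, cleared of denominators.
[1+t]^i*t≤ : ∀ t i → 2 * i ≤ t → suc t ^ i * t ≤ t ^ i * (t + 2 * i)
[1+t]^i*t≤ t zero    _    = ≤-reflexive (cong (1 *_) (sym (+-identityʳ t)))
[1+t]^i*t≤ t (suc i) 2i≤t = begin
  suc t * suc t ^ i * t          ≡⟨ *-assoc (suc t) (suc t ^ i) t ⟩
  suc t * (suc t ^ i * t)        ≤⟨ *-monoʳ-≤ (suc t) ([1+t]^i*t≤ t i (≤-trans (*-monoʳ-≤ 2 (n≤1+n i)) 2i≤t)) ⟩
  suc t * (t ^ i * (t + 2 * i))  ≡⟨ ident₁ t i (t ^ i) ⟩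
  t ^ i * (t * t + t + 2 * (i * t) + 2 * i)   ≤⟨ *-monoʳ-≤ (t ^ i) (+-monoʳ-≤ (t * t + t + 2 * (i * t)) (≤-trans (*-monoʳ-≤ 2 (n≤1+n i)) 2i≤t)) ⟩
  t ^ i * (t * t + t + 2 * (i * t) + t)       ≡⟨ ident₂ t i (t ^ i) ⟩
  t * t ^ i * (t + 2 * suc i)    ∎
  where
  open ≤-Reasoning
  ident₁ : ∀ t i p → suc t * (p * (t + 2 * i)) ≡ p * (t * t + t + 2 * (i * t) + 2 * i)
  ident₁ = solve-∀
  ident₂ : ∀ t i p → p * (t * t + t + 2 * (i * t) + t) ≡ t * p * (t + 2 * suc i)
  ident₂ = solve-∀

[1+2s]^s≤2*[2s]^s : ∀ s .{{_ : NonZero s}} → suc (2 * s) ^ s ≤ 2 * (2 * s) ^ s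
[1+2s]^s≤2*[2s]^s s = *-cancelʳ-≤ _ _ (2 * s) {{m*n≢0 2 s}}
  (≤-trans ([1+t]^i*t≤ (2 * s) s ≤-refl) (≤-reflexive (ident ((2 * s) ^ s) (2 * s))))
  where
  ident : ∀ p t → p * (t + t) ≡ 2 * p * t
  ident = solve-∀

n≤2^n : ∀ n → n ≤ 2 ^ n
n≤2^n zero    = z≤n
n≤2^n (suc n) = ≤-trans (+-mono-≤ (m^n>0 2 n) (n≤2^n n)) (+-monoʳ-≤ (2 ^ n) (m≤m+n (2 ^ n) 0))

-- Raise `length≤` to the power `s = 2 Q`. With `t = 2 s` the factor `(1 + 1/t) ^ (s M)` is at most
-- `2 ^ M`, and `r = M / (t s)` gives `t ^ (r s) ≤ 2 ^ (t r s) ≤ 2 ^ M`. The square root of the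
-- product is `2 ^ M`.
sparse-family-bound : ∀ {A : Set} (b : A → ℕ → Bool) Q M xs .{{_ : NonZero Q}} → Separated b M xs →
  All (λ x → 2 * (2 * Q) * (2 * Q) * cnt (b x) M ≤ M) xs → length xs ^ Q ≤ 2 ^ M
sparse-family-bound b Q M xs sep sparse = ^-cancelˡ-≤ 2 (begin
  (length xs ^ Q) ^ 2   ≡⟨ trans (^-*-assoc (length xs) Q 2) (cong (length xs ^_) (*-comm Q 2)) ⟩
  length xs ^ s         ≤⟨ power ⟩
  (t ^ r) ^ s * 2 ^ M   ≤⟨ *-monoˡ-≤ (2 ^ M) t^rs≤ ⟩
  2 ^ M * 2 ^ M         ≡⟨ cong (2 ^ M *_) (*-identityʳ (2 ^ M)) ⟨
  (2 ^ M) ^ 2           ∎)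
  where
  open ≤-Reasoning
  s t r : ℕ
  s = 2 * Q
  t = 2 * s
  instance
    s≢0 : NonZero s
    s≢0 = m*n≢0 2 Q
    t≢0 : NonZero t
    t≢0 = m*n≢0 2 s
    ts≢0 : NonZero (t * s)
    ts≢0 = m*n≢0 t s
  r = M / (t * s)

  r*ts≤M : r * (t * s) ≤ M
  r*ts≤M = m/n*n≤m M (t * s)

  cnt≤r : ∀ {c} → t * s * c ≤ M → c ≤ r
  cnt≤r {c} h = ≤-trans (≤-reflexive (sym (m*n/n≡m c (t * s)))) (/-monoˡ-≤ (t * s) (≤-trans (≤-reflexive (*-comm c (t * s))) h))

  t^rs≤ : (t ^ r) ^ s ≤ 2 ^ M
  t^rs≤ = begin
    (t ^ r) ^ s         ≡⟨ ^-*-assoc t r s ⟩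
    t ^ (r * s)         ≤⟨ ^-monoˡ-≤ (r * s) (n≤2^n t) ⟩
    (2 ^ t) ^ (r * s)   ≡⟨ ^-*-assoc 2 t (r * s) ⟩
    2 ^ (t * (r * s))   ≡⟨ cong (2 ^_) (ident t r s) ⟩
    2 ^ (r * (t * s))   ≤⟨ ^-monoʳ-≤ 2 r*ts≤M ⟩
    2 ^ M               ∎
    where
    ident : ∀ t r s → t * (r * s) ≡ r * (t * s)
    ident = solve-∀

  power : length xs ^ s ≤ (t ^ r) ^ s * 2 ^ M
  power = *-cancelʳ-≤ _ _ ((t ^ s) ^ M) {{m^n≢0 (t ^ s) M {{m^n≢0 t s}}}} (begin
    length xs ^ s * (t ^ s) ^ M          ≡⟨ cong (length xs ^ s *_) (^-swap t s M) ⟩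
    length xs ^ s * (t ^ M) ^ s          ≡⟨ ^-distribʳ-* (length xs) (t ^ M) s ⟨
    (length xs * t ^ M) ^ s              ≤⟨ ^-monoˡ-≤ s (length≤ b t M r xs sep (All.map cnt≤r sparse)) ⟩
    (t ^ r * suc t ^ M) ^ s              ≡⟨ ^-distribʳ-* (t ^ r) (suc t ^ M) s ⟩
    (t ^ r) ^ s * (suc t ^ M) ^ s        ≡⟨ cong ((t ^ r) ^ s *_) (^-swap (suc t) M s) ⟩
    (t ^ r) ^ s * (suc t ^ s) ^ M        ≤⟨ *-monoʳ-≤ ((t ^ r) ^ s) (^-monoˡ-≤ M ([1+2s]^s≤2*[2s]^s s)) ⟩
    (t ^ r) ^ s * (2 * t ^ s) ^ M        ≡⟨ cong ((t ^ r) ^ s *_) (^-distribʳ-* 2 (t ^ s) M) ⟩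
    (t ^ r) ^ s * (2 ^ M * (t ^ s) ^ M)  ≡⟨ *-assoc ((t ^ r) ^ s) (2 ^ M) _ ⟨
    (t ^ r) ^ s * 2 ^ M * (t ^ s) ^ M    ∎)

-- The order of 3 modulo powers of 2

2∣odd*x⇒2∣x : ∀ a x → 2 ∣ suc (2 * a) * x → 2 ∣ x
2∣odd*x⇒2∣x a x h = ∣m+n∣m⇒∣n {2} {2 * (a * x)} {x} (subst (2 ∣_) (ident a x) h) (m∣m*n (a * x))
  where
  ident : ∀ a x → suc (2 * a) * x ≡ 2 * (a * x) + x
  ident = solve-∀

odd-cancel : ∀ M a x → 2 ^ M ∣ suc (2 * a) * x → 2 ^ M ∣ x
odd-cancel zero    a x _ = 1∣ x
odd-cancel (suc M) a x h with divides y refl ← 2∣odd*x⇒2∣x a x (∣-trans (m∣m*n (2 ^ M)) h) =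
  subst (2 ^ suc M ∣_) (*-comm 2 y)
    (*-monoʳ-∣ 2 (odd-cancel M a y (*-cancelˡ-∣ 2 (subst (2 ^ suc M ∣_) (ident a y) h))))
  where
  ident : ∀ a y → suc (2 * a) * (y * 2) ≡ 2 * (suc (2 * a) * y)
  ident = solve-∀

even-or-odd : ∀ j → ∃[ i ] (j ≡ 2 * i ⊎ j ≡ suc (2 * i))
even-or-odd zero = 0 , inj₁ refl
even-or-odd (suc j) with even-or-odd j
... | i , inj₁ refl = i , inj₂ refl
... | i , inj₂ refl = suc i , inj₁ (sym (*-suc 2 i))

9^i≡1 : ∀ i → ∃[ y ] 3 ^ (2 * i) ≡ suc (8 * y)
9^i≡1 zero    = 0 , refl
9^i≡1 (suc i) with y , eq ← 9^i≡1 i = suc (9 * y) ,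
  trans (cong (3 ^_) (*-suc 2 i)) (trans (cong (λ z → 3 * (3 * z)) eq) (ident y))
  where
  ident : ∀ y → 3 * (3 * suc (8 * y)) ≡ suc (8 * suc (9 * y))
  ident = solve-∀

3*9^i≡3 : ∀ i → ∃[ y ] 3 ^ suc (2 * i) ≡ 3 + 8 * y
3*9^i≡3 i with y , eq ← 9^i≡1 i = 3 * y , trans (cong (3 *_) eq) (ident y)
  where
  ident : ∀ y → 3 * suc (8 * y) ≡ 3 + 8 * (3 * y)
  ident = solve-∀

3^k-odd : ∀ k → ∃[ a ] 3 ^ k ≡ suc (2 * a)
3^k-odd zero    = 0 , refl
3^k-odd (suc k) with a , eq ← 3^k-odd k = suc (3 * a) , trans (cong (3 *_) eq) (ident a)
  where
  ident : ∀ a → 3 * suc (2 * a) ≡ suc (2 * suc (3 * a))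
  ident = solve-∀

-- For `j = 2 i`, factor `3 ^ j − 1 = (3 ^ i − 1) (3 ^ i + 1)` and read off the powers of 2 from
-- `3 ^ i` modulo 8.
order-of-3 : ∀ m j x → 3 ^ j ≡ suc x → 2 ^ (2 + m) ∣ x → 2 ^ m ∣ j
order-of-3 zero    j x _  _ = 1∣ j
order-of-3 (suc m) j x eq h with even-or-odd j
... | i , inj₂ refl with y , 3ʲ≡ ← 3*9^i≡3 i =
  -- For odd `j`, `3 ^ j − 1` is 2 modulo 8, so 4 does not divide it.
  contradiction (∣m+n∣m⇒∣n {4} {8 * y} {2} (subst (4 ∣_) (trans (suc-injective (trans (sym eq) 3ʲ≡)) (+-comm 2 (8 * y))) (∣-trans 4∣ h))
                  (∣-trans (divides 2 refl) (m∣m*n y))) (from-no (4 ∣? 2))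
  where
  4∣ : 4 ∣ 2 ^ (3 + m)
  4∣ = divides (2 ^ suc m) (ident (2 ^ m))
    where
    ident : ∀ p → 2 * (2 * (2 * p)) ≡ 2 * p * 4
    ident = solve-∀
... | i , inj₁ refl with even-or-odd i
...   | l , inj₁ refl with y , 3ⁱ≡ ← 9^i≡1 l =
  -- For even `i`, `3 ^ i + 1 = 2 (4 y + 1)` takes exactly one factor 2 and leaves the rest to
  -- `3 ^ i − 1`.
  *-monoʳ-∣ 2 (order-of-3 m (2 * l) (8 * y) 3ⁱ≡
    (*-cancelˡ-∣ 2 (odd-cancel (3 + m) (2 * y) (2 * (8 * y)) (subst (2 ^ (3 + m) ∣_) x≡ h))))
  where
  square : ∀ y → suc (8 * y) * suc (8 * y) ≡ suc (suc (2 * (2 * y)) * (2 * (8 * y)))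
  square = solve-∀
  x≡ : x ≡ suc (2 * (2 * y)) * (2 * (8 * y))
  x≡ = suc-injective (trans (sym eq) (trans (cong (3 ^_) (cong (2 * l +_) (+-identityʳ (2 * l))))
         (trans (^-distribˡ-+-* 3 (2 * l) (2 * l)) (trans (cong₂ _*_ 3ⁱ≡ 3ⁱ≡) (square y)))))
-- For odd `i`, exactly `2 ^ 3` divides `3 ^ j − 1`. Here only evenness of `j` is claimed; any
-- larger exponent is contradictory.
order-of-3 (suc zero)    j x eq h | i , inj₁ refl | l , inj₂ refl = m∣m*n (suc (2 * l))
order-of-3 (suc (suc m)) j x eq h | i , inj₁ refl | l , inj₂ refl with y , 3ⁱ≡ ← 3*9^i≡3 l =
  contradiction (∣-trans 16∣ (odd-cancel (4 + m) (2 * y) 8 (odd-cancel (4 + m) y _ (subst (2 ^ (4 + m) ∣_) x≡ h)))) (from-no (16 ∣? 8))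
  where
  square : ∀ y → (3 + 8 * y) * (3 + 8 * y) ≡ suc (suc (2 * y) * (suc (2 * (2 * y)) * 8))
  square = solve-∀
  x≡ : x ≡ suc (2 * y) * (suc (2 * (2 * y)) * 8)
  x≡ = suc-injective (trans (sym eq) (trans (cong (3 ^_) (cong (suc (2 * l) +_) (+-identityʳ (suc (2 * l)))))
         (trans (^-distribˡ-+-* 3 (suc (2 * l)) (suc (2 * l))) (trans (cong₂ _*_ 3ⁱ≡ 3ⁱ≡) (square y)))))
  16∣ : 16 ∣ 2 ^ (4 + m)
  16∣ = divides (2 ^ m) (ident (2 ^ m))
    where
    ident : ∀ p → 2 * (2 * (2 * (2 * p))) ≡ p * 16
    ident = solve-∀

-- Binary digits and residues

digit-tail : Expansion 2 → Expansion 2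
digit-tail []       = []
digit-tail (_ ∷ ds) = ds

digitAt-suc : ∀ ds i → digitAt ds (suc i) ≡ digitAt (digit-tail ds) i
digitAt-suc []       i = refl
digitAt-suc (_ ∷ ds) i = refl

fromDigits-cons : ∀ ds → fromDigits ds ≡ toℕ (digitAt ds 0) + fromDigits (digit-tail ds) * 2
fromDigits-cons []      = refl
fromDigits-cons (d ∷ _) = refl

common-residue : ∀ M (xs ys : Expansion 2) → (∀ i → i < M → digitAt xs i ≡ digitAt ys i) →
  ∃[ r ] ∃[ u ] ∃[ v ] (fromDigits xs ≡ r + u * 2 ^ M × fromDigits ys ≡ r + v * 2 ^ M)
common-residue zero    xs ys _ = 0 , fromDigits xs , fromDigits ys , sym (*-identityʳ _) , sym (*-identityʳ _)
common-residue (suc M) xs ys agree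
  with r , u , v , eqx , eqy ← common-residue M (digit-tail xs) (digit-tail ys) (λ i i<M →
         trans (sym (digitAt-suc xs i)) (trans (agree (suc i) (s≤s i<M)) (digitAt-suc ys i)))
  = toℕ (digitAt xs 0) + r * 2 , u , v
  , step xs r u eqx
  , trans (step ys r v eqy) (cong (λ d → toℕ d + r * 2 + v * 2 ^ suc M) (sym (agree 0 (s≤s z≤n))))
  where
  step : ∀ ds r u → fromDigits (digit-tail ds) ≡ r + u * 2 ^ M →
         fromDigits ds ≡ toℕ (digitAt ds 0) + r * 2 + u * 2 ^ suc M
  step ds r u eq = trans (fromDigits-cons ds) (trans (cong (λ z → toℕ (digitAt ds 0) + z * 2) eq) (ident (toℕ (digitAt ds 0)) r u (2 ^ M)))
    where
    ident : ∀ d r u p → d + (r + u * p) * 2 ≡ d + r * 2 + u * (2 * p)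
    ident = solve-∀

∣-from-residues : ∀ {p r u v x y} → x ≡ r + u * p → x + y ≡ r + v * p → p ∣ y
∣-from-residues {p} {r} {u} {v} {x} {y} eq eq′ = ∣m+n∣m⇒∣n (divides v key) (divides u refl)
  where
  key : u * p + y ≡ v * p
  key = +-cancelˡ-≡ r _ _ (trans (sym (+-assoc r _ y)) (trans (cong (_+ y) (sym eq)) eq′))

-- The two powers differ by `3 ^ k (3 ^ j − 1)`, and the odd factor `3 ^ k` cancels modulo `2 ^ M`.
3^k-cancel : ∀ {M k j r u v} → 3 ^ k ≡ r + u * 2 ^ M → 3 ^ (k + j) ≡ r + v * 2 ^ M →
             ∃[ x ] (3 ^ j ≡ suc x × 2 ^ M ∣ x)
3^k-cancel {M} {k} {j} {r} {u} {v} eq eq′ =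
  let a , 3ᵏ≡ = 3^k-odd k
      b , 3ʲ≡ = 3^k-odd j
  in  2 * b , 3ʲ≡ , odd-cancel M a (2 * b) (∣-from-residues {u = u} {v} (trans (sym 3ᵏ≡) eq) (begin
        suc (2 * a) + suc (2 * a) * (2 * b)  ≡⟨ *-suc (suc (2 * a)) (2 * b) ⟨
        suc (2 * a) * suc (2 * b)            ≡⟨ cong₂ _*_ 3ᵏ≡ 3ʲ≡ ⟨
        3 ^ k * 3 ^ j                        ≡⟨ ^-distribˡ-+-* 3 k j ⟨
        3 ^ (k + j)                          ≡⟨ eq′ ⟩
        r + v * 2 ^ M                        ∎))
  where open ≡-Reasoning

low-digits-determine : ∀ m k j xs ys → fromDigits xs ≡ 3 ^ k → fromDigits ys ≡ 3 ^ (k + j) →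
  (∀ i → i < 2 + m → digitAt xs i ≡ digitAt ys i) → 2 ^ m ∣ j
low-digits-determine m k j xs ys xs≡ ys≡ agree =
  let r , u , v , eq , eq′ = common-residue (2 + m) xs ys agree
      x , 3ʲ≡ , p∣x = 3^k-cancel {2 + m} {k} {j} {r} {u} {v} (trans (sym xs≡) eq) (trans (sym ys≡) eq′)
  in  order-of-3 m j x 3ʲ≡ p∣x

ω-separates : ∀ m k j → (∀ i → i < 2 + m → ω i k ≡ ω i (k + j)) → 2 ^ m ∣ j
ω-separates m k j = low-digits-determine m k j (binary (3 ^ k)) (binary (3 ^ (k + j)))
  (proj₂ (toDigits 2 (3 ^ k))) (proj₂ (toDigits 2 (3 ^ (k + j))))

-- The count of W

isOne : Bit → Bool
isOne zero       = false
isOne (suc zero) = true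

isOne-true : ∀ {d} → isOne d ≡ true → d ≡ 1b
isOne-true {suc zero} _ = refl

isOne-injective : ∀ {d e} → isOne d ≡ isOne e → d ≡ e
isOne-injective {zero}     {zero}     _ = refl
isOne-injective {zero}     {suc zero} ()
isOne-injective {suc zero} {suc zero} _ = refl

bit : ℕ → ℕ → Bool
bit k i = isOne (ω i k)

W⇒APFree : ∀ k → W k → APFree (bit k)
W⇒APFree k w a d p q r = w (a , suc d , s≤s z≤n , isOne-true p , isOne-true q , isOne-true r)

-- Agreement would make `l − k` a positive multiple of `2 ^ m`, hence at least `2 ^ m`.
bits-separate : ∀ m {k l} → k < l → l ≤ 2 ^ m + k → ¬ l ≡ 2 ^ m + k → ¬ Agree bit (2 + m) k l
bits-separate m {k} k<l l≤ l≢ agree with j , refl ← m≤n⇒∃[o]m+o≡n k<l = l≢ (≤-antisym l≤ (begin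
  2 ^ m + k     ≤⟨ +-monoˡ-≤ k (∣⇒≤ (ω-separates m k (suc j) λ i i<M →
                     isOne-injective (trans (agree i i<M) (cong (λ l → bit l i) (sym (+-suc k j)))))) ⟩
  suc j + k     ≡⟨ cong suc (+-comm j k) ⟩
  suc k + j     ∎))
  where open ≤-Reasoning

-- Lets the word length be a multiple of `n` at the cost of a constant factor.
between-powers : ∀ X → 2 ≤ X → ∀ N → 1 ≤ N → ∃[ B ] (N ≤ X ^ B × X ^ B ≤ X * N)
between-powers X 2≤X (suc zero) _ = 0 , ≤-refl , ≤-trans (<⇒≤ 2≤X) (≤-reflexive (sym (*-identityʳ X)))
between-powers X 2≤X (suc N@(suc _)) _ with B , N≤ , ≤XN ← between-powers X 2≤X N (s≤s z≤n) | suc N ≤? X ^ B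
... | yes N<Xᴮ = B , N<Xᴮ , ≤-trans ≤XN (*-monoʳ-≤ X (n≤1+n N))
... | no  N≮Xᴮ = suc B , ≤-trans 1+N≤X*N (*-monoʳ-≤ X N≤) , *-monoʳ-≤ X (≮⇒≥ λ N+1<Xᴮ → N≮Xᴮ (<⇒≤ N+1<Xᴮ))
  where
  1+N≤X*N : suc N ≤ X * N
  1+N≤X*N = ≤-trans (+-monoˡ-≤ N (s≤s z≤n)) (≤-trans (≤-reflexive (cong (N +_) (sym (+-identityʳ N)))) (*-monoˡ-≤ N 2≤X))

-- Words of length `(2 + B) n` are used, where `(2 ^ n) ^ B` lies between `N` and `2 ^ n N`. The
-- length is a multiple of `n`, so the density bound applies blockwise, and at least `2 + n B`, so
-- the low digits separate the exponents up to `N`.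
density⇒W-count : ∀ Q n .{{_ : NonZero Q}} .{{_ : NonZero n}} →
  DensityBound (2 * (2 * Q) * (2 * Q)) 1 n → ∀ N → 1 ≤ N → #W∩[1, N ] ^ Q ≤ 2 ^ (2 * n + n) * N
density⇒W-count Q n bound N 1≤N with B , N≤ , ≤XN ← between-powers (2 ^ n) (^-monoʳ-≤ 2 (>-nonZero⁻¹ n)) N 1≤N = begin
  #W∩[1, N ] ^ Q           ≤⟨ sparse-family-bound bit Q ((2 + B) * n) _
                                (AllPairs.filter⁺ W? (AllPairs.applyUpTo⁺₁ suc N separated))
                                (All.map (λ {k} → sparse k) (all-filter W? (applyUpTo suc N))) ⟩
  2 ^ ((2 + B) * n)        ≡⟨ cong (2 ^_) (ident B n) ⟩
  2 ^ (2 * n + n * B)      ≡⟨ ^-distribˡ-+-* 2 (2 * n) (n * B) ⟩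
  2 ^ (2 * n) * 2 ^ (n * B) ≡⟨ cong (2 ^ (2 * n) *_) (^-*-assoc 2 n B) ⟨
  2 ^ (2 * n) * (2 ^ n) ^ B ≤⟨ *-monoʳ-≤ (2 ^ (2 * n)) ≤XN ⟩
  2 ^ (2 * n) * (2 ^ n * N) ≡⟨ *-assoc (2 ^ (2 * n)) (2 ^ n) N ⟨
  2 ^ (2 * n) * 2 ^ n * N  ≡⟨ cong (_* N) (^-distribˡ-+-* 2 (2 * n) n) ⟨
  2 ^ (2 * n + n) * N                    ∎
  where
  D : ℕ
  D = 2 * (2 * Q) * (2 * Q)
  open ≤-Reasoning
  ident : ∀ B n → (2 + B) * n ≡ 2 * n + n * B
  ident = solve-∀

  sparse : ∀ k → W k → D * cnt (bit k) ((2 + B) * n) ≤ (2 + B) * n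
  sparse k w = ≤-trans (blocks-bound {D} {1} bound (bit k) (W⇒APFree k w) (2 + B) _ ≤-refl)
                   (*-monoʳ-≤ (2 + B) (≤-reflexive (*-identityˡ n)))

  N≤2^ : N ≤ 2 ^ (n * B)
  N≤2^ = ≤-trans N≤ (≤-reflexive (^-*-assoc 2 n B))

  2+nB≤ : 2 + n * B ≤ (2 + B) * n
  2+nB≤ = ≤-trans (+-monoˡ-≤ (n * B) (*-monoʳ-≤ 2 (>-nonZero⁻¹ n))) (≤-reflexive (sym (ident B n)))

  separated : ∀ {i j} → i < j → j < N → ¬ Agree bit ((2 + B) * n) (suc i) (suc j)
  separated {i} {j} i<j j<N agree = bits-separate (n * B) (s≤s i<j) (<⇒≤ near) (<⇒≢ near)
    (λ x x< → agree x (≤-trans x< 2+nB≤))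
    where
    near : suc j < 2 ^ (n * B) + suc i
    near = begin-strict
      suc j                   ≤⟨ ≤-trans j<N N≤2^ ⟩
      2 ^ (n * B)             <⟨ m<m+n _ (s≤s z≤n) ⟩
      2 ^ (n * B) + suc i     ∎

W-count : ∀ Q .{{_ : NonZero Q}} → ∃[ C ] (NonZero C × (∀ N → 1 ≤ N → #W∩[1, N ] ^ Q ≤ C * N))
W-count Q =
  let n , n≢0 , bound = roth (2 * (2 * Q) * (2 * Q)) {{D≢0}}
  in  2 ^ (2 * n + n) , m^n≢0 2 (2 * n + n) , (let instance _ = n≢0 in density⇒W-count Q n bound)
  where
  instance
    2Q≢0 : NonZero (2 * Q)
    2Q≢0 = m*n≢0 2 Q
    4Q≢0 : NonZero (2 * (2 * Q))
    4Q≢0 = m*n≢0 2 (2 * Q)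
  D≢0 : NonZero (2 * (2 * Q) * (2 * Q))
  D≢0 = m*n≢0 (2 * (2 * Q)) (2 * Q)

-- Rational and real exponents

-- Since `1/Q ≤ p/q`, `N ^ (q/Q) ≤ N ^ p`; comparing `Q`-th powers avoids the roots.
power-transfer : ∀ {m C N Q q p} .{{_ : NonZero Q}} .{{_ : NonZero C}} → 1 ≤ N → q ≤ p * Q → m ^ Q ≤ C * N → m ^ q ≤ C ^ q * N ^ p
power-transfer {m} {C} {N} {Q} {q} {p} 1≤N q≤pQ h = ^-cancelˡ-≤ Q (begin
  (m ^ q) ^ Q              ≡⟨ ^-swap m q Q ⟩
  (m ^ Q) ^ q              ≤⟨ ^-monoˡ-≤ q h ⟩
  (C * N) ^ q              ≡⟨ ^-distribʳ-* C N q ⟩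
  C ^ q * N ^ q            ≤⟨ *-mono-≤ (≤-trans (≤-reflexive (sym (*-identityʳ (C ^ q)))) (^-monoʳ-≤ (C ^ q) {{m^n≢0 C q}} (>-nonZero⁻¹ Q)))
                                (^-monoʳ-≤ N {{>-nonZero 1≤N}} q≤pQ) ⟩
  (C ^ q) ^ Q * N ^ (p * Q) ≡⟨ cong ((C ^ q) ^ Q *_) (^-*-assoc N p Q) ⟨
  (C ^ q) ^ Q * (N ^ p) ^ Q ≡⟨ ^-distribʳ-* (C ^ q) (N ^ p) Q ⟨
  (C ^ q * N ^ p) ^ Q       ∎)
  where open ≤-Reasoning

lower<upper : ∀ (ε : ℝ) {q r} → ℝ.lower ε q → ℝ.upper ε r → q ℚ.< r
lower<upper ε {q} {r} lq ur with ℚ.<-cmp q r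
... | tri< q<r _ _    = q<r
... | tri≈ _ refl _   = ⊥-elim (ℝ.disjoint ε q (lq , ur))
... | tri> _ _ r<q    = ⊥-elim (ℝ.disjoint ε r (Equivalence.from (ℝ.lower-rounded ε r) (q , r<q , lq) , ur))

-- A positive `q` is at least the reciprocal of its denominator, so the exponent `1 / ↧ₙ q` serves
-- every `r` above `q`.
bound-above : ∀ m C N q .{{_ : NonZero C}} → 0ℚ ℚ.< q → ∀ r → q ℚ.< r → 1 ≤ N → m ^ ↧ₙ q ≤ C * N → m ≤ C · N ^ℚ r
bound-above m C N (mkℚ (ℤ.+ zero) _ _)   (*<* (ℤ.+<+ ()))
bound-above m C N (mkℚ ℤ.-[1+ _ ] _ _)   (*<* ())
bound-above m C N (mkℚ (ℤ.+ suc a) d _) 0<q (mkℚ ℤ.-[1+ _ ] _ _) (*<* ())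
bound-above m C N (mkℚ (ℤ.+ suc a) d _) 0<q (mkℚ (ℤ.+ p) b _) (*<* q<r) 1≤N h =
  -- Cross-multiplying `q < r` gives `(a + 1) (b + 1) < p (d + 1)`, and `b + 1` is at most the left
  -- side.
  power-transfer {m} {C} {N} {suc d} {suc b} {p} 1≤N (≤-trans (m≤m+n (suc b) (a * suc b)) (<⇒≤ (ℤ.drop‿+<+ (subst (ℤ.+ (suc a * suc b) ℤ.<_) (sym (ℤ.pos-* p (suc d))) q<r)))) h

theorem6p2 : (ε : ℝ) → Positive ε → ∃[ C ] ((N : ℕ) → 1 ≤ N → #W∩[1, N ] ≤ C · N ^ℝ ε)
theorem6p2 ε 0<ε =
  -- Roundedness supplies a rational `q` with `0 < q < ε`; its denominator fixes `C` before `N` and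
  -- `r` are given.
  let q , 0<q , q∈lower = Equivalence.to (ℝ.lower-rounded ε 0ℚ) 0<ε
      C , C≢0 , count   = W-count (↧ₙ q)
  in  C , λ N 1≤N r r∈upper → bound-above #W∩[1, N ] C N q {{C≢0}} 0<q r (lower<upper ε q∈lower r∈upper) 1≤N (count N 1≤N)
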